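{- Let $n\ge 2$ be an integer with $r$ distinct prime factors. Let $D=\mathrm{diag}(-1,0,0,\dots,0)$ be of order $2^r$ and $\tilde Q_n=Q_n-D$. Then for each $1\le j\le 2^r$, $$\lambda_j(\tilde Q_n)+\lambda_{2^r}(D)\le \lambda_j(Q_n)\le \lambda_j(\tilde Q_n)+\lambda_1(D).$$
   Context: For a real symmetric $m\times m$ matrix $X$, $\lambda_1(X)\ge\lambda_2(X)\ge\dots\ge\lambda_m(X)$ denote its eigenvalues in decreasing order, with multiplicity. Let $p_1<\dots<p_r$ be the distinct primes dividing $n$ and $n_0=p_1\cdots p_r$. The divisors of $n_0$ are ordered as $(d_1,\dots,d_{2^r})$ recursively: for $r=1$ the order is $(1,p_1)$, and for $r$ primes the first $2^{r-1}$ entries are those for the primes $p_1,\dots,p_{r-1}$, the remaining $2^{r-1}$ entries being obtained by multiplying each of these, in order, by $p_r$. For a divisor $d$ of $n_0$, $[d]=\{a\in\{0,1,\dots,n-1\}:\gcd(a,n_0)=d\}$ (with $\gcd(0,n_0)=n_0$), and $a_i=|[d_{i+1}]|$ for $1\le i\le 2^r-1$. $Q_n$ is the symmetric real $2^r\times 2^r$ matrix whose $(1,1)$ entry is $\varphi(n)-1$, whose other diagonal entries are $0$, and whose off-diagonal entries are $\rho_{i,j}$, where $\rho_{1,j}=\rho_{j,1}=\sqrt{\varphi(n)a_{j-1}}$ for $j\ge2$, and for $i\neq j$ with $i,j\ge 2$, $\rho_{i,j}=\sqrt{a_{i-1}a_{j-1}}$ if $\gcd(d_i,d_j)=1$ and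 $\rho_{i,j}=0$ otherwise. $\varphi$ is Euler's totient function. -}

module Defs where

import Algebra.Properties.AbelianGroup
import Algebra.Properties.CommutativeSemigroup
import Algebra.Properties.Ring
open import Algebra.Bundles using (AbelianGroup)
open import Data.Bool.Base using (if_then_else_)
open import Data.Fin.Base as Fin using (Fin; toℕ; fromℕ<; opposite)
import Data.Fin.Properties as Fin
open import Data.Integer.Base as ℤ using (ℤ; +_)
import Data.Integer.Properties as ℤ
open import Data.List.Base as List using (List; length; filter; upTo)
open import Data.Nat.Base as ℕ using (ℕ; zero; suc)
open import Data.Nat.Divisibility using (_∣?_)
open import Data.Nat.GCD using (gcd)
open import Data.Nat.ListAction using (product)
open import Data.Nat.Primality using (prime?)
import Data.Nat.Properties as ℕ
open import Data.Nat.Tactic.RingSolver using (solve-∀)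
open import Data.Product.Base using (∃-syntax; _,_; proj₁; proj₂; _×_)
open import Data.Rational.Base as ℚ using (ℚ; mkℚ; 0ℚ; 1ℚ; ½)
import Data.Rational.Properties as ℚ
import Data.Rational.Unnormalised.Base as ℚᵘ
import Data.Rational.Unnormalised.Properties as ℚᵘ
open import Data.Sum.Base as Sum using ()
open import Data.Vec.Base as Vec using (Vec; []; _∷_)
open import Data.Vec.Functional as Vector using (Vector)
open import Relation.Binary.PropositionalEquality
  using (_≡_; refl; sym; trans; cong; cong₂; subst; subst₂)
open import Relation.Nullary.Decidable using (Dec; yes; no; does; _×-dec_)
open import Relation.Nullary.Negation using (¬_)

-- The modulus of convergence is data. Equality of reals is _≃_, not _≡_.

IsCauchy : (ℕ → ℚ) → Set
IsCauchy s = ∀ ε → 0ℚ ℚ.< ε →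
  ∃[ N ] (∀ m n → N ℕ.≤ m → N ℕ.≤ n → ℚ.∣ s m ℚ.- s n ∣ ℚ.< ε)

record ℝ : Set where
  constructor mkℝ
  field
    seq    : ℕ → ℚ
    cauchy : IsCauchy seq

open ℝ public

infix 4 _≃_ _≤_

_≃_ : ℝ → ℝ → Set
x ≃ y = ∀ ε → 0ℚ ℚ.< ε →
  ∃[ N ] (∀ n → N ℕ.≤ n → ℚ.∣ seq x n ℚ.- seq y n ∣ ℚ.< ε)

_≤_ : ℝ → ℝ → Set
x ≤ y = ∀ ε → 0ℚ ℚ.< ε →
  ∃[ N ] (∀ n → N ℕ.≤ n → seq x n ℚ.< seq y n ℚ.+ ε)

private
  module ℚ+ where
    open AbelianGroup ℚ.+-0-abelianGroup using (commutativeSemigroup)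
    open Algebra.Properties.AbelianGroup ℚ.+-0-abelianGroup public
    open Algebra.Properties.CommutativeSemigroup commutativeSemigroup public
      using (interchange)
  module ℚ* = Algebra.Properties.Ring ℚ.+-*-ring

abstract

  telescope : ∀ p q r → (p ℚ.- q) ℚ.+ (q ℚ.- r) ≡ p ℚ.- r
  telescope p q r = trans (sym (ℚ.+-assoc (p ℚ.- q) q (ℚ.- r)))
                          (cong (ℚ._- r) (ℚ+.//-rightDividesˡ q p))

  ∣p-p∣≡0 : ∀ p → ℚ.∣ p ℚ.- p ∣ ≡ 0ℚ
  ∣p-p∣≡0 p = cong ℚ.∣_∣ (ℚ.+-inverseʳ p)

  ∣p-q∣≡∣q-p∣ : ∀ p q → ℚ.∣ p ℚ.- q ∣ ≡ ℚ.∣ q ℚ.- p ∣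
  ∣p-q∣≡∣q-p∣ p q = trans (sym (ℚ.∣-p∣≡∣p∣ (p ℚ.- q))) (cong ℚ.∣_∣ (ℚ+.⁻¹-anti-homo‿- p q))

  half : ∀ ε → 0ℚ ℚ.< ε → 0ℚ ℚ.< ½ ℚ.* ε
  half ε 0<ε = subst (ℚ._< ½ ℚ.* ε) (ℚ.*-zeroʳ ½) (ℚ.*-monoʳ-<-pos ½ {0ℚ} {ε} 0<ε)

  half+half : ∀ ε → ½ ℚ.* ε ℚ.+ ½ ℚ.* ε ≡ ε
  half+half ε = trans (sym (ℚ.*-distribʳ-+ ε ½ ½)) (ℚ.*-identityˡ ε)

  const-cauchy : ∀ q → IsCauchy (λ _ → q)
  const-cauchy q ε 0<ε =
    0 , λ _ _ _ _ → subst (ℚ._< ε) (sym (∣p-p∣≡0 q)) 0<ε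

  +-cauchy : ∀ x y → IsCauchy (λ n → seq x n ℚ.+ seq y n)
  +-cauchy x y ε 0<ε = N₁ ℕ.⊔ N₂ , bound
    where
    δ : ℚ
    δ = ½ ℚ.* ε
    N₁ N₂ : ℕ
    N₁ = proj₁ (cauchy x δ (half ε 0<ε))
    N₂ = proj₁ (cauchy y δ (half ε 0<ε))

    rearrange : ∀ a b c d → (a ℚ.+ b) ℚ.- (c ℚ.+ d) ≡ (a ℚ.- c) ℚ.+ (b ℚ.- d)
    rearrange a b c d =
      trans (cong (a ℚ.+ b ℚ.+_) (ℚ.neg-distrib-+ c d))
            (ℚ+.interchange a b (ℚ.- c) (ℚ.- d))

    bound : ∀ m n → N₁ ℕ.⊔ N₂ ℕ.≤ m → N₁ ℕ.⊔ N₂ ℕ.≤ n →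
            ℚ.∣ (seq x m ℚ.+ seq y m) ℚ.- (seq x n ℚ.+ seq y n) ∣ ℚ.< ε
    bound m n N≤m N≤n = begin-strict
      ℚ.∣ (seq x m ℚ.+ seq y m) ℚ.- (seq x n ℚ.+ seq y n) ∣
        ≡⟨ cong ℚ.∣_∣ (rearrange (seq x m) (seq y m) (seq x n) (seq y n)) ⟩
      ℚ.∣ (seq x m ℚ.- seq x n) ℚ.+ (seq y m ℚ.- seq y n) ∣
        ≤⟨ ℚ.∣p+q∣≤∣p∣+∣q∣ (seq x m ℚ.- seq x n) (seq y m ℚ.- seq y n) ⟩
      ℚ.∣ seq x m ℚ.- seq x n ∣ ℚ.+ ℚ.∣ seq y m ℚ.- seq y n ∣
        <⟨ ℚ.+-mono-<
             (proj₂ (cauchy x δ (half ε 0<ε)) m n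
               (ℕ.m⊔n≤o⇒m≤o N₁ N₂ N≤m) (ℕ.m⊔n≤o⇒m≤o N₁ N₂ N≤n))
             (proj₂ (cauchy y δ (half ε 0<ε)) m n
               (ℕ.m⊔n≤o⇒n≤o N₁ N₂ N≤m) (ℕ.m⊔n≤o⇒n≤o N₁ N₂ N≤n)) ⟩
      δ ℚ.+ δ
        ≡⟨ half+half ε ⟩
      ε ∎
      where open ℚ.≤-Reasoning

  neg-cauchy : ∀ x → IsCauchy (λ n → ℚ.- seq x n)
  neg-cauchy x ε 0<ε = proj₁ (cauchy x ε 0<ε) , λ m n N≤m N≤n →
    subst (ℚ._< ε)
      (trans (∣p-q∣≡∣q-p∣ (seq x m) (seq x n))
             (cong ℚ.∣_∣ (rearrange (seq x m) (seq x n))))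
      (proj₂ (cauchy x ε 0<ε) m n N≤m N≤n)
    where
    rearrange : ∀ a b → b ℚ.- a ≡ (ℚ.- a) ℚ.- (ℚ.- b)
    rearrange a b =
      trans (sym (ℚ+.⁻¹-anti-homo‿- a b)) (ℚ.neg-distrib-+ a (ℚ.- b))

  0<1 : 0ℚ ℚ.< 1ℚ
  0<1 = ℚ.positive⁻¹ 1ℚ

  eventually-bounded : ∀ x →
    ∃[ B ] ∃[ N ] (0ℚ ℚ.< B × (∀ n → N ℕ.≤ n → ℚ.∣ seq x n ∣ ℚ.≤ B))
  eventually-bounded x = ℚ.∣ seq x N ∣ ℚ.+ 1ℚ , N , 0<B , bound
    where
    N : ℕ
    N = proj₁ (cauchy x 1ℚ 0<1)

    0<B : 0ℚ ℚ.< ℚ.∣ seq x N ∣ ℚ.+ 1ℚ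
    0<B = ℚ.+-mono-≤-< (ℚ.0≤∣p∣ (seq x N)) 0<1

    split : ∀ a b → a ≡ b ℚ.+ (a ℚ.- b)
    split a b = trans (sym (ℚ+.//-rightDividesˡ b a)) (ℚ.+-comm (a ℚ.- b) b)

    bound : ∀ n → N ℕ.≤ n → ℚ.∣ seq x n ∣ ℚ.≤ ℚ.∣ seq x N ∣ ℚ.+ 1ℚ
    bound n N≤n = begin
      ℚ.∣ seq x n ∣
        ≡⟨ cong ℚ.∣_∣ (split (seq x n) (seq x N)) ⟩
      ℚ.∣ seq x N ℚ.+ (seq x n ℚ.- seq x N) ∣
        ≤⟨ ℚ.∣p+q∣≤∣p∣+∣q∣ (seq x N) (seq x n ℚ.- seq x N) ⟩
      ℚ.∣ seq x N ∣ ℚ.+ ℚ.∣ seq x n ℚ.- seq x N ∣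
        ≤⟨ ℚ.+-monoʳ-≤ ℚ.∣ seq x N ∣
             (ℚ.<⇒≤ (proj₂ (cauchy x 1ℚ 0<1) n N N≤n ℕ.≤-refl)) ⟩
      ℚ.∣ seq x N ∣ ℚ.+ 1ℚ ∎
      where open ℚ.≤-Reasoning

  scaled-tolerance : ∀ B ε → 0ℚ ℚ.< B → 0ℚ ℚ.< ε →
                     ∃[ δ ] (0ℚ ℚ.< δ × B ℚ.* δ ≡ ε)
  scaled-tolerance B ε 0<B 0<ε = 1/B ℚ.* ε , 0<δ , B*δ≡ε
    where
    instance
      B-positive : ℚ.Positive B
      B-positive = ℚ.positive 0<B
      B-nonZero : ℚ.NonZero B
      B-nonZero = ℚ.pos⇒nonZero B
    1/B : ℚ
    1/B = ℚ.1/ B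
    instance
      1/B-positive : ℚ.Positive 1/B
      1/B-positive = ℚ.1/pos⇒pos B

    0<δ : 0ℚ ℚ.< 1/B ℚ.* ε
    0<δ = subst (ℚ._< 1/B ℚ.* ε) (ℚ.*-zeroʳ 1/B) (ℚ.*-monoʳ-<-pos 1/B 0<ε)

    B*δ≡ε : B ℚ.* (1/B ℚ.* ε) ≡ ε
    B*δ≡ε = trans (sym (ℚ.*-assoc B 1/B ε))
      (trans (cong (ℚ._* ε) (ℚ.*-inverseʳ B)) (ℚ.*-identityˡ ε))

  *-cauchy : ∀ x y → IsCauchy (λ n → seq x n ℚ.* seq y n)
  *-cauchy x y ε 0<ε = (Mx ℕ.⊔ My) ℕ.⊔ (Nx ℕ.⊔ Ny) , bound
    where
    Bx By δ : ℚ
    Mx My Nx Ny : ℕ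
    Bx = proj₁ (eventually-bounded x)
    By = proj₁ (eventually-bounded y)
    Mx = proj₁ (proj₂ (eventually-bounded x))
    My = proj₁ (proj₂ (eventually-bounded y))

    0<Bx : 0ℚ ℚ.< Bx
    0<Bx = proj₁ (proj₂ (proj₂ (eventually-bounded x)))
    0<By : 0ℚ ℚ.< By
    0<By = proj₁ (proj₂ (proj₂ (eventually-bounded y)))
    ∣x∣≤Bx : ∀ n → Mx ℕ.≤ n → ℚ.∣ seq x n ∣ ℚ.≤ Bx
    ∣x∣≤Bx = proj₂ (proj₂ (proj₂ (eventually-bounded x)))
    ∣y∣≤By : ∀ n → My ℕ.≤ n → ℚ.∣ seq y n ∣ ℚ.≤ By
    ∣y∣≤By = proj₂ (proj₂ (proj₂ (eventually-bounded y)))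

    tolerance : ∃[ δ ] (0ℚ ℚ.< δ × (Bx ℚ.+ By) ℚ.* δ ≡ ε)
    tolerance = scaled-tolerance (Bx ℚ.+ By) ε (ℚ.+-mono-< 0<Bx 0<By) 0<ε
    δ = proj₁ tolerance
    0<δ : 0ℚ ℚ.< δ
    0<δ = proj₁ (proj₂ tolerance)
    B*δ≡ε : (Bx ℚ.+ By) ℚ.* δ ≡ ε
    B*δ≡ε = proj₂ (proj₂ tolerance)

    Nx = proj₁ (cauchy x δ 0<δ)
    Ny = proj₁ (cauchy y δ 0<δ)
    x-close : ∀ m n → Nx ℕ.≤ m → Nx ℕ.≤ n → ℚ.∣ seq x m ℚ.- seq x n ∣ ℚ.< δ
    x-close = proj₂ (cauchy x δ 0<δ)
    y-close : ∀ m n → Ny ℕ.≤ m → Ny ℕ.≤ n → ℚ.∣ seq y m ℚ.- seq y n ∣ ℚ.< δ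
    y-close = proj₂ (cauchy y δ 0<δ)

    rearrange : ∀ a b c d →
      a ℚ.* b ℚ.- c ℚ.* d ≡ a ℚ.* (b ℚ.- d) ℚ.+ d ℚ.* (a ℚ.- c)
    rearrange a b c d = sym (trans
      (cong₂ ℚ._+_
        (ℚ*.x[y-z]≈xy-xz a b d)
        (trans (ℚ*.x[y-z]≈xy-xz d a c)
               (cong₂ ℚ._-_ (ℚ.*-comm d a) (ℚ.*-comm d c))))
      (telescope (a ℚ.* b) (a ℚ.* d) (c ℚ.* d)))

    product-bound : ∀ {p q B} → 0ℚ ℚ.< B → ℚ.∣ p ∣ ℚ.≤ B → ℚ.∣ q ∣ ℚ.< δ →
                    ℚ.∣ p ℚ.* q ∣ ℚ.< B ℚ.* δ
    product-bound {p} {q} {B} 0<B ∣p∣≤B ∣q∣<δ = begin-strict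
      ℚ.∣ p ℚ.* q ∣         ≡⟨ ℚ.∣p*q∣≡∣p∣*∣q∣ p q ⟩
      ℚ.∣ p ∣ ℚ.* ℚ.∣ q ∣  ≤⟨ ℚ.*-monoʳ-≤-nonNeg ℚ.∣ q ∣ {{ℚ.nonNegative (ℚ.0≤∣p∣ q)}} ∣p∣≤B ⟩
      B ℚ.* ℚ.∣ q ∣         <⟨ ℚ.*-monoʳ-<-pos B {{ℚ.positive 0<B}} ∣q∣<δ ⟩
      B ℚ.* δ               ∎
      where open ℚ.≤-Reasoning

    bound : ∀ m n → (Mx ℕ.⊔ My) ℕ.⊔ (Nx ℕ.⊔ Ny) ℕ.≤ m →
            (Mx ℕ.⊔ My) ℕ.⊔ (Nx ℕ.⊔ Ny) ℕ.≤ n →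
            ℚ.∣ seq x m ℚ.* seq y m ℚ.- seq x n ℚ.* seq y n ∣ ℚ.< ε
    bound m n K≤m K≤n = begin-strict
      ℚ.∣ xm ℚ.* ym ℚ.- xn ℚ.* yn ∣
        ≡⟨ cong ℚ.∣_∣ (rearrange xm ym xn yn) ⟩
      ℚ.∣ xm ℚ.* (ym ℚ.- yn) ℚ.+ yn ℚ.* (xm ℚ.- xn) ∣
        ≤⟨ ℚ.∣p+q∣≤∣p∣+∣q∣ (xm ℚ.* (ym ℚ.- yn)) (yn ℚ.* (xm ℚ.- xn)) ⟩
      ℚ.∣ xm ℚ.* (ym ℚ.- yn) ∣ ℚ.+ ℚ.∣ yn ℚ.* (xm ℚ.- xn) ∣
        <⟨ ℚ.+-mono-<
             (product-bound 0<Bx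
               (∣x∣≤Bx m (ℕ.m⊔n≤o⇒m≤o Mx My (left K≤m)))
               (y-close m n (ℕ.m⊔n≤o⇒n≤o Nx Ny (right K≤m)) (ℕ.m⊔n≤o⇒n≤o Nx Ny (right K≤n))))
             (product-bound 0<By
               (∣y∣≤By n (ℕ.m⊔n≤o⇒n≤o Mx My (left K≤n)))
               (x-close m n (ℕ.m⊔n≤o⇒m≤o Nx Ny (right K≤m)) (ℕ.m⊔n≤o⇒m≤o Nx Ny (right K≤n)))) ⟩
      Bx ℚ.* δ ℚ.+ By ℚ.* δ
        ≡⟨ ℚ.*-distribʳ-+ δ Bx By ⟨
      (Bx ℚ.+ By) ℚ.* δ
        ≡⟨ B*δ≡ε ⟩
      ε ∎
      where
      open ℚ.≤-Reasoning
      xm xn ym yn : ℚ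
      xm = seq x m
      xn = seq x n
      ym = seq y m
      yn = seq y n
      left : ∀ {k} → (Mx ℕ.⊔ My) ℕ.⊔ (Nx ℕ.⊔ Ny) ℕ.≤ k → Mx ℕ.⊔ My ℕ.≤ k
      left = ℕ.m⊔n≤o⇒m≤o (Mx ℕ.⊔ My) (Nx ℕ.⊔ Ny)
      right : ∀ {k} → (Mx ℕ.⊔ My) ℕ.⊔ (Nx ℕ.⊔ Ny) ℕ.≤ k → Nx ℕ.⊔ Ny ℕ.≤ k
      right = ℕ.m⊔n≤o⇒n≤o (Mx ℕ.⊔ My) (Nx ℕ.⊔ Ny)

infix  8 -_
infixl 7 _*_
infixl 6 _+_ _-_

fromℚ : ℚ → ℝ
fromℚ q = mkℝ (λ _ → q) (const-cauchy q)

fromℕ : ℕ → ℝ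
fromℕ n = fromℚ (+ n ℚ./ 1)

0ℝ 1ℝ : ℝ
0ℝ = fromℕ 0
1ℝ = fromℕ 1

_+_ _*_ : ℝ → ℝ → ℝ
x + y = mkℝ (λ n → seq x n ℚ.+ seq y n) (+-cauchy x y)
x * y = mkℝ (λ n → seq x n ℚ.* seq y n) (*-cauchy x y)

-_ : ℝ → ℝ
-_ x = mkℝ (λ n → ℚ.- seq x n) (neg-cauchy x)

_-_ : ℝ → ℝ → ℝ
x - y = x + (- y)

advance : ℕ → ℕ → ℕ
advance a s = if does (suc s ℕ.* suc s ℕ.≤? a) then suc s else s

⌊√_⌋ : ℕ → ℕ
⌊√ zero ⌋  = 0
⌊√ suc a ⌋ = advance (suc a) ⌊√ a ⌋

-- ⌊√(a(k+1)²)⌋ / (k+1) is √a rounded down to a multiple of 1/(k+1).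
√-approx : ℕ → ℕ → ℚ
√-approx a k = + ⌊√ a ℕ.* (suc k ℕ.* suc k) ⌋ ℚ./ suc k

abstract

  if-dec : ∀ {A : Set} (A? : Dec A) (P : ℕ → Set) {x y} →
           (A → P x) → (¬ A → P y) → P (if does A? then x else y)
  if-dec (yes p) P f g = f p
  if-dec (no ¬p) P f g = g ¬p

  ⌊√⌋-spec : ∀ a → ⌊√ a ⌋ ℕ.* ⌊√ a ⌋ ℕ.≤ a × a ℕ.< suc ⌊√ a ⌋ ℕ.* suc ⌊√ a ⌋
  ⌊√⌋-spec zero = ℕ.z≤n , ℕ.s≤s ℕ.z≤n
  ⌊√⌋-spec (suc a) =
    if-dec (t ℕ.* t ℕ.≤? suc a) (λ s → s ℕ.* s ℕ.≤ suc a × suc a ℕ.< suc s ℕ.* suc s)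
      (λ t²≤1+a → t²≤1+a , ℕ.≤-<-trans (proj₂ (⌊√⌋-spec a))
                             (ℕ.*-mono-< (ℕ.n<1+n t) (ℕ.n<1+n t)))
      (λ t²≰1+a → ℕ.m≤n⇒m≤1+n (proj₁ (⌊√⌋-spec a)) , ℕ.≰⇒> t²≰1+a)
    where
    t : ℕ
    t = suc ⌊√ a ⌋

  square-cancel-< : ∀ m n → m ℕ.* m ℕ.< n ℕ.* n → m ℕ.< n
  square-cancel-< m n m²<n² =
    ℕ.≰⇒> λ n≤m → ℕ.<⇒≱ m²<n² (ℕ.*-mono-≤ n≤m n≤m)

  √-cross : ∀ a K L .{{_ : ℕ.NonZero K}} →
    ⌊√ a ℕ.* (K ℕ.* K) ⌋ ℕ.* L ℕ.< suc ⌊√ a ℕ.* (L ℕ.* L) ⌋ ℕ.* K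
  √-cross a K L = square-cancel-< (S ℕ.* L) (suc T ℕ.* K) (begin-strict
    (S ℕ.* L) ℕ.* (S ℕ.* L)
      ≡⟨ interchange S L ⟩
    (S ℕ.* S) ℕ.* (L ℕ.* L)
      ≤⟨ ℕ.*-monoˡ-≤ (L ℕ.* L) (proj₁ (⌊√⌋-spec (a ℕ.* (K ℕ.* K)))) ⟩
    a ℕ.* (K ℕ.* K) ℕ.* (L ℕ.* L)
      ≡⟨ swap a K L ⟩
    a ℕ.* (L ℕ.* L) ℕ.* (K ℕ.* K)
      <⟨ ℕ.*-monoˡ-< (K ℕ.* K) {{ℕ.m*n≢0 K K}} (proj₂ (⌊√⌋-spec (a ℕ.* (L ℕ.* L)))) ⟩
    (suc T ℕ.* suc T) ℕ.* (K ℕ.* K)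
      ≡⟨ interchange (suc T) K ⟨
    (suc T ℕ.* K) ℕ.* (suc T ℕ.* K) ∎)
    where
    open ℕ.≤-Reasoning
    S T : ℕ
    S = ⌊√ a ℕ.* (K ℕ.* K) ⌋
    T = ⌊√ a ℕ.* (L ℕ.* L) ⌋
    interchange : ∀ p q → (p ℕ.* q) ℕ.* (p ℕ.* q) ≡ (p ℕ.* p) ℕ.* (q ℕ.* q)
    interchange = solve-∀
    swap : ∀ a p q → a ℕ.* (p ℕ.* p) ℕ.* (q ℕ.* q) ≡ a ℕ.* (q ℕ.* q) ℕ.* (p ℕ.* p)
    swap = solve-∀

  /-cross-< : ∀ m n k l → m ℕ.* suc l ℕ.< n ℕ.* suc k → + m ℚ./ suc k ℚ.< + n ℚ./ suc l
  /-cross-< m n k l ml<nk = ℚ.toℚᵘ-cancel-<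
    (ℚᵘ.<-respˡ-≃ (ℚᵘ.≃-sym (ℚ.toℚᵘ-fromℚᵘ (ℚᵘ.mkℚᵘ (+ m) k)))
    (ℚᵘ.<-respʳ-≃ (ℚᵘ.≃-sym (ℚ.toℚᵘ-fromℚᵘ (ℚᵘ.mkℚᵘ (+ n) l)))
    (ℚᵘ.*<* (subst₂ ℤ._<_ (ℤ.pos-* m (suc l)) (ℤ.pos-* n (suc k)) (ℤ.+<+ ml<nk)))))

  suc-/ : ∀ n k → + suc n ℚ./ suc k ≡ + n ℚ./ suc k ℚ.+ + 1 ℚ./ suc k
  suc-/ n k = ℚ.toℚᵘ-injective
    (ℚᵘ.≃-trans (ℚ.toℚᵘ-fromℚᵘ (ℚᵘ.mkℚᵘ (+ suc n) k))
    (ℚᵘ.≃-trans (ℚᵘ.*≡* cross)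
    (ℚᵘ.≃-sym
      (ℚᵘ.≃-trans (ℚ.toℚᵘ-homo-+ (+ n ℚ./ suc k) (+ 1 ℚ./ suc k))
                  (ℚᵘ.+-cong (ℚ.toℚᵘ-fromℚᵘ (ℚᵘ.mkℚᵘ (+ n) k)) (ℚ.toℚᵘ-fromℚᵘ (ℚᵘ.mkℚᵘ (+ 1) k)))))))
    where
    arith : ∀ n K → suc n ℕ.* (K ℕ.* K) ≡ (n ℕ.* K ℕ.+ 1 ℕ.* K) ℕ.* K
    arith = solve-∀
    K : ℕ
    K = suc k
    cross : + suc n ℤ.* + (K ℕ.* K) ≡ (+ n ℤ.* + K ℤ.+ + 1 ℤ.* + K) ℤ.* + K
    cross = trans (sym (ℤ.pos-* (suc n) (K ℕ.* K)))
      (trans (cong +_ (arith n K))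
      (trans (ℤ.pos-* (n ℕ.* K ℕ.+ 1 ℕ.* K) K)
             (cong (ℤ._* + K) (cong₂ ℤ._+_ (ℤ.pos-* n K) (ℤ.pos-* 1 K)))))

  archimedean : ∀ ε → 0ℚ ℚ.< ε → ∃[ N ] (∀ n → N ℕ.≤ n → + 1 ℚ./ suc n ℚ.< ε)
  archimedean ε@(mkℚ (+ zero)    d-1 _) (ℚ.*<* (ℤ.+<+ ()))
  archimedean ε@(mkℚ (+ (suc m)) d-1 _) _ = suc d-1 , λ n d≤n →
    subst (+ 1 ℚ./ suc n ℚ.<_) (ℚ.↥p/↧p≡p ε)
      (/-cross-< 1 (suc m) n d-1
        (subst (ℕ._< suc m ℕ.* suc n) (sym (ℕ.*-identityˡ (suc d-1)))
          (ℕ.≤-trans (ℕ.s≤s d≤n) (ℕ.m≤m+n (suc n) (m ℕ.* suc n)))))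
  archimedean ε@(mkℚ (ℤ.-[1+ _ ]) d-1 _) (ℚ.*<* ())

  √-approx-< : ∀ a k l → √-approx a k ℚ.< √-approx a l ℚ.+ + 1 ℚ./ suc l
  √-approx-< a k l = subst (√-approx a k ℚ.<_) (suc-/ ⌊√ a ℕ.* (suc l ℕ.* suc l) ⌋ l)
    (/-cross-< ⌊√ a ℕ.* (suc k ℕ.* suc k) ⌋ (suc ⌊√ a ℕ.* (suc l ℕ.* suc l) ⌋) k l
      (√-cross a (suc k) (suc l)))

  √-cauchy : ∀ a → IsCauchy (√-approx a)
  √-cauchy a ε 0<ε = N , bound
    where
    N : ℕ
    N = proj₁ (archimedean ε 0<ε)
    small : ∀ n → N ℕ.≤ n → + 1 ℚ./ suc n ℚ.< ε
    small = proj₂ (archimedean ε 0<ε)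

    difference : ∀ {p q r} → p ℚ.< q ℚ.+ r → p ℚ.- q ℚ.< r
    difference {p} {q} {r} p<q+r =
      subst (p ℚ.- q ℚ.<_) (ℚ+.xyx⁻¹≈y q r) (ℚ.+-monoˡ-< (ℚ.- q) p<q+r)

    one-sided : ∀ m n → N ℕ.≤ n → √-approx a m ℚ.- √-approx a n ℚ.< ε
    one-sided m n N≤n =
      ℚ.<-trans (difference (√-approx-< a m n)) (small n N≤n)

    bound : ∀ m n → N ℕ.≤ m → N ℕ.≤ n → ℚ.∣ √-approx a m ℚ.- √-approx a n ∣ ℚ.< ε
    bound m n N≤m N≤n = ∣p∣<ε (√-approx a m ℚ.- √-approx a n) (one-sided m n N≤n)
      (subst (ℚ._< ε) (sym (ℚ+.⁻¹-anti-homo‿- (√-approx a m) (√-approx a n)))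
        (one-sided n m N≤m))
      where
      ∣p∣<ε : ∀ p → p ℚ.< ε → ℚ.- p ℚ.< ε → ℚ.∣ p ∣ ℚ.< ε
      ∣p∣<ε p p<ε -p<ε = Sum.[ (λ eq → subst (ℚ._< ε) (sym eq) p<ε)
                             , (λ eq → subst (ℚ._< ε) (sym eq) -p<ε)
                             ]′ (ℚ.∣p∣≡p∨∣p∣≡-p p)

√ : ℕ → ℝ
√ a = mkℝ (√-approx a) (√-cauchy a)

Matrix : ℕ → Set
Matrix m = Fin m → Fin m → ℝ

_-ᴹ_ : ∀ {m} → Matrix m → Matrix m → Matrix m
(X -ᴹ Y) i j = X i j - Y i j

diagonal : ∀ {m} → Vector ℝ m → Matrix m
diagonal v i j = if does (i Fin.≟ j) then v i else 0ℝ

∑ ∏ : ∀ {m} → Vector ℝ m → ℝ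
∑ = Vector.foldr _+_ 0ℝ
∏ = Vector.foldr _*_ 1ℝ

alternate : ℕ → ℝ → ℝ
alternate zero    x = x
alternate (suc k) x = - alternate k x

det : ∀ {m} → Matrix m → ℝ
det {zero}  X = 1ℝ
det {suc m} X = ∑ λ j →
  alternate (toℕ j) (X Fin.zero j * det (λ i → Vector.removeAt (X (Fin.suc i)) j))

charPoly : ∀ {m} → Matrix m → ℝ → ℝ
charPoly X t = det (diagonal (λ _ → t) -ᴹ X)

-- λ₁ ≥ … ≥ λₘ, listed with multiplicity as roots of the characteristic
-- polynomial. A polynomial over ℝ is determined by its values, and the
-- characteristic polynomial of a real symmetric matrix splits, so such a
-- list exists and is unique up to _≃_. Index i stands for λᵢ₊₁.
record Eigenvalues {m : ℕ} (X : Matrix m) : Set where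
  field
    eig        : Fin m → ℝ
    decreasing : ∀ {i j} → i Fin.≤ j → eig j ≤ eig i
    splits     : ∀ t → charPoly X t ≃ ∏ (λ i → t - eig i)

open Eigenvalues public

φ : ℕ → ℕ
φ n = length (filter (λ a → gcd a n ℕ.≟ 1) (List.map suc (upTo n)))

primeDivisors : ℕ → List ℕ
primeDivisors n = filter (λ p → prime? p ×-dec p ∣? n) (upTo (suc n))

ω : ℕ → ℕ
ω n = length (primeDivisors n)

rad : ℕ → ℕ
rad n = product (primeDivisors n)

-- The trailing [] matches 2 ^ suc r = 2 ^ r + (2 ^ r + 0).
appendMultiples : ∀ {r} → Vec ℕ (2 ℕ.^ r) → ℕ → Vec ℕ (2 ℕ.^ suc r)
appendMultiples ds p = ds Vec.++ (Vec.map (p ℕ.*_) ds Vec.++ [])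

orderedDivisors : ∀ {r} → Vec ℕ r → Vec ℕ (2 ℕ.^ r)
orderedDivisors = Vec.foldl (λ r → Vec ℕ (2 ℕ.^ r)) (λ {r} → appendMultiples {r}) (1 ∷ [])

-- d n i is the divisor dᵢ₊₁.
d : ∀ n → Fin (2 ℕ.^ ω n) → ℕ
d n = Vec.lookup (orderedDivisors (Vec.fromList (primeDivisors n)))

∣[_]∣ : ℕ → ℕ → ℕ
∣[ n ]∣ e = length (filter (λ a → gcd a (rad n) ℕ.≟ e) (upTo n))

-- a n i is |[dᵢ₊₁]|; for toℕ i ≥ 1 this is the quantity aᵢ.
a : ∀ n → Fin (2 ℕ.^ ω n) → ℕ
a n i = ∣[ n ]∣ (d n i)

ρ : ∀ n → Matrix (2 ℕ.^ ω n)
ρ n i j with toℕ i | toℕ j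
... | zero  | _     = √ (φ n ℕ.* a n j)
... | suc _ | zero  = √ (φ n ℕ.* a n i)
... | suc _ | suc _ =
  if does (gcd (d n i) (d n j) ℕ.≟ 1) then √ (a n i ℕ.* a n j) else 0ℝ

firstEntry : ∀ {m} → ℝ → Vector ℝ m
firstEntry x i = if does (toℕ i ℕ.≟ 0) then x else 0ℝ

Q : ∀ n → Matrix (2 ℕ.^ ω n)
Q n i j =
  if does (i Fin.≟ j) then firstEntry (fromℕ (φ n) - 1ℝ) i else ρ n i j

D : ∀ r → Matrix (2 ℕ.^ r)
D r = diagonal (firstEntry (- 1ℝ))

Q̃ : ∀ n → Matrix (2 ℕ.^ ω n)
Q̃ n = Q n -ᴹ D (ω n)

first last : ∀ r → Fin (2 ℕ.^ r)
first r = fromℕ< (ℕ.m^n>0 2 r)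
last  r = opposite (first r)

{-# OPTIONS --safe #-}

-- Write f and g for the characteristic polynomials of Q and of Q̃ = Q + e₁e₁ᵀ, and
-- a(t) for the vector of first-row cofactors of tI − Q. Then f − g = a₁, and
-- symmetry of Q gives f(s)g(t) − g(s)f(t) = (t − s) a(s)·a(t). Letting s → t,
--
--   f g′ − f′ g = a·a ≥ (f − g)².
--
-- This inequality survives cancelling a common root of f and g. Once there is
-- none, let λ and μ be the decreasing roots of f and g: at the first i with λᵢ > μᵢ the
-- left side would be ≤ 0 at λᵢ by counting signs, and the right side g(λᵢ)² > 0.
-- Hence λⱼ ≤ μⱼ. As Σ μ − Σ λ = 1 by comparing the second coefficients, also
-- μⱼ ≤ λⱼ + 1. Finally −1 and 0 are eigenvalues of D.
--
-- Comparisons of constructive reals are decided under a double negation, which the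
-- goal absorbs; limits are sequences in u = 1/(k+1) with error O(u).

module Submission where

open import Defs
open import Algebra.Bundles using (CommutativeRing)
import Algebra.Properties.CommutativeMonoid.Sum
import Algebra.Properties.Semiring.Sum
import Algebra.Solver.Ring
import Algebra.Solver.Ring.AlmostCommutativeRing as ACR
open import Algebra.Structures using (IsCommutativeRing)
open import Data.Bool.Base using (true; false; if_then_else_)
open import Data.Fin.Base as Fin using (Fin; toℕ; punchIn; fromℕ<)
import Data.Fin.Properties as Fin
open import Data.Integer.Base using (+_)
open import Data.List.Base as List using ()
open import Data.List.Membership.Propositional.Properties using (∈-length; ∈-filter⁺; ∈-upTo⁺)
open import Data.List.Relation.Unary.All as All using ()
open import Data.Maybe.Base as Maybe using (Maybe)
open import Data.Nat.Base as ℕ using (ℕ; zero; suc)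
open import Data.Nat.Divisibility using (_∣_; _∣?_; ∣⇒≤; m∣m*n; ∣-reflexive; ∣-trans)
open import Data.Nat.GCD using (gcd-comm)
open import Data.Nat.Primality using (Prime; prime?)
open import Data.Nat.Primality.Factorisation using (factorise)
import Data.Nat.Properties as ℕ
open import Data.Product.Base using (∃-syntax; _×_; _,_; proj₁; proj₂)
open import Data.Rational.Base as ℚ using (ℚ; 0ℚ; 1ℚ; ½)
import Data.Rational.Properties as ℚ
import Data.Rational.Unnormalised.Base as ℚᵘ
import Data.Rational.Unnormalised.Properties as ℚᵘ
open import Data.Sum.Base using (_⊎_; inj₁; inj₂)
open import Data.Unit.Base using (⊤; tt)
open import Data.Vec.Functional using (Vector; _∷_; removeAt; head; tail)
open import Level using (0ℓ)
open import Relation.Binary.PropositionalEquality as ≡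
  using (_≡_; _≗_; refl; sym; trans; cong; subst; subst₂)
import Relation.Binary.Reasoning.Setoid
open import Relation.Nullary.Decidable
  using (Dec; yes; no; does; dec-true; dec-false; dec⇒maybe; _×-dec_)
open import Relation.Nullary.Negation using (¬_; contradiction)
import Tactic.RingSolver
open import Tactic.RingSolver.Core.AlmostCommutativeRing as Tactic using (AlmostCommutativeRing)

-- `Eigenvalues` supplies numbers that factor the values of the characteristic polynomial, and no
-- eigenvectors; hence every comparison runs through polynomials instead of a variational
-- characterisation. Derivatives and coefficients are not read off a formal polynomial either: they
-- arise as limits of division-free difference quotients, the derivative at a finite point and the
-- second coefficient at infinity.
--
-- The square (f - g)² is what makes the inequality decisive. At a root of f it reads -f′ g ≥ g², so
-- f′ g ≥ 0 already forces g = 0. The weaker f g′ - f′ g ≥ 0 would give only f′ g ≤ 0, which a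
-- multiple root of f satisfies with g ≠ 0. The contradiction needs g ≠ 0 there, which is why common
-- roots must go; both sides of the inequality are homogeneous of degree two in (f, g), so removing
-- a common factor z divides them by z².

private
  variable
    m : ℕ

-- The ring of real numbers

-- _≃_ unfolds to a Π-type, which hides its arguments from unification.
infix 4 _≈_
record _≈_ (x y : ℝ) : Set where
  constructor mk≈
  field un≈ : x ≃ y

open _≈_ public

≡⇒≈ : ∀ {x y} → (∀ n → seq x n ≡ seq y n) → x ≈ y
≡⇒≈ {x} {y} eq = mk≈ λ ε 0<ε → 0 , λ n _ →
  subst (ℚ._< ε) (sym (trans (cong (λ p → ℚ.∣ p ℚ.- seq y n ∣) (eq n)) (∣p-p∣≡0 (seq y n)))) 0<ε

≈-refl : ∀ {x} → x ≈ x
≈-refl = ≡⇒≈ λ _ → refl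

≈-sym : ∀ {x y} → x ≈ y → y ≈ x
≈-sym {x} {y} (mk≈ e) = mk≈ λ ε 0<ε → proj₁ (e ε 0<ε) , λ n N≤n →
  subst (ℚ._< ε) (∣p-q∣≡∣q-p∣ (seq x n) (seq y n)) (proj₂ (e ε 0<ε) n N≤n)

-- `Null (x - y)` unfolds to `x ≃ y`, so the congruence laws of the ring reduce to closure of null
-- sequences under sums and multiples.
record Null (x : ℝ) : Set where
  constructor mkNull
  field un : ∀ ε → 0ℚ ℚ.< ε → ∃[ N ] (∀ n → N ℕ.≤ n → ℚ.∣ seq x n ∣ ℚ.< ε)

≈⇒Null : ∀ {x y} → x ≈ y → Null (x - y)
≈⇒Null (mk≈ e) = mkNull e

Null⇒≈ : ∀ {x y} → Null (x - y) → x ≈ y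
Null⇒≈ (mkNull e) = mk≈ e

Null-≡ : ∀ {x y} → (∀ n → seq x n ≡ seq y n) → Null x → Null y
Null-≡ eq (mkNull e) = mkNull λ ε 0<ε → proj₁ (e ε 0<ε) , λ n le →
  subst (λ p → ℚ.∣ p ∣ ℚ.< ε) (eq n) (proj₂ (e ε 0<ε) n le)

Null-+ : ∀ {x y} → Null x → Null y → Null (x + y)
Null-+ {x} {y} (mkNull e) (mkNull f) = mkNull λ ε 0<ε →
  let (M , p) = e (½ ℚ.* ε) (half ε 0<ε)
      (N , q) = f (½ ℚ.* ε) (half ε 0<ε)
  in M ℕ.⊔ N , λ n le → begin-strict
    ℚ.∣ seq x n ℚ.+ seq y n ∣
      ≤⟨ ℚ.∣p+q∣≤∣p∣+∣q∣ (seq x n) (seq y n) ⟩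
    ℚ.∣ seq x n ∣ ℚ.+ ℚ.∣ seq y n ∣
      <⟨ ℚ.+-mono-< (p n (ℕ.m⊔n≤o⇒m≤o M N le)) (q n (ℕ.m⊔n≤o⇒n≤o M N le)) ⟩
    ½ ℚ.* ε ℚ.+ ½ ℚ.* ε
      ≡⟨ half+half ε ⟩
    ε ∎
  where open ℚ.≤-Reasoning

≈-trans : ∀ {x y z} → x ≈ y → y ≈ z → x ≈ z
≈-trans {x} {y} {z} p q = Null⇒≈
  (Null-≡ (λ n → telescope (seq x n) (seq y n) (seq z n)) (Null-+ (≈⇒Null p) (≈⇒Null q)))

Null-*ˡ : ∀ x {y} → Null y → Null (x * y)
Null-*ˡ x {y} (mkNull e) = mkNull λ ε 0<ε →
  let (B , M , 0<B , ∣x∣≤B) = eventually-bounded x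
      (δ , 0<δ , Bδ≡ε)      = scaled-tolerance B ε 0<B 0<ε
      (N , ∣y∣<δ)           = e δ 0<δ
  in M ℕ.⊔ N , λ n le → begin-strict
    ℚ.∣ seq x n ℚ.* seq y n ∣
      ≡⟨ ℚ.∣p*q∣≡∣p∣*∣q∣ (seq x n) (seq y n) ⟩
    ℚ.∣ seq x n ∣ ℚ.* ℚ.∣ seq y n ∣
      ≤⟨ ℚ.*-monoʳ-≤-nonNeg ℚ.∣ seq y n ∣ {{ℚ.nonNegative (ℚ.0≤∣p∣ (seq y n))}}
           (∣x∣≤B n (ℕ.m⊔n≤o⇒m≤o M N le)) ⟩
    B ℚ.* ℚ.∣ seq y n ∣
      <⟨ ℚ.*-monoʳ-<-pos B {{ℚ.positive 0<B}} (∣y∣<δ n (ℕ.m⊔n≤o⇒n≤o M N le)) ⟩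
    B ℚ.* δ
      ≡⟨ Bδ≡ε ⟩
    ε ∎
  where open ℚ.≤-Reasoning

ℚring : AlmostCommutativeRing 0ℓ 0ℓ
ℚring = Tactic.fromCommutativeRing ℚ.+-*-commutativeRing λ p → dec⇒maybe (0ℚ ℚ.≟ p)

private
  +-diff : ∀ a b c d → (a ℚ.- b) ℚ.+ (c ℚ.- d) ≡ (a ℚ.+ c) ℚ.- (b ℚ.+ d)
  +-diff = Tactic.RingSolver.solve-∀ ℚring

  *-diff : ∀ a b c d → a ℚ.* (c ℚ.- d) ℚ.+ d ℚ.* (a ℚ.- b) ≡ a ℚ.* c ℚ.- b ℚ.* d
  *-diff = Tactic.RingSolver.solve-∀ ℚring

  neg-diff : ∀ a b → (b ℚ.- a) ≡ (ℚ.- a) ℚ.- (ℚ.- b)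
  neg-diff = Tactic.RingSolver.solve-∀ ℚring

+-cong : ∀ {x y u v} → x ≈ y → u ≈ v → x + u ≈ y + v
+-cong {x} {y} {u} {v} p q = Null⇒≈
  (Null-≡ (λ n → +-diff (seq x n) (seq y n) (seq u n) (seq v n))
    (Null-+ (≈⇒Null p) (≈⇒Null q)))

*-cong : ∀ {x y u v} → x ≈ y → u ≈ v → x * u ≈ y * v
*-cong {x} {y} {u} {v} p q = Null⇒≈
  (Null-≡ (λ n → *-diff (seq x n) (seq y n) (seq u n) (seq v n))
    (Null-+ (Null-*ˡ x (≈⇒Null q)) (Null-*ˡ v (≈⇒Null p))))

neg-cong : ∀ {x y} → x ≈ y → - x ≈ - y
neg-cong {x} {y} p = Null⇒≈
  (Null-≡ (λ n → neg-diff (seq x n) (seq y n)) (≈⇒Null (≈-sym p)))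

ℝ-isCommutativeRing : IsCommutativeRing _≈_ _+_ _*_ -_ 0ℝ 1ℝ
ℝ-isCommutativeRing = record
  { isRing = record
    { +-isAbelianGroup = record
      { isGroup = record
        { isMonoid = record
          { isSemigroup = record
            { isMagma = record
              { isEquivalence = record { refl = ≈-refl ; sym = ≈-sym ; trans = ≈-trans }
              ; ∙-cong = +-cong
              }
            ; assoc = λ x y z → ≡⇒≈ λ n → ℚ.+-assoc (seq x n) (seq y n) (seq z n)
            }
          ; identity = (λ x → ≡⇒≈ λ n → ℚ.+-identityˡ (seq x n))
                     , (λ x → ≡⇒≈ λ n → ℚ.+-identityʳ (seq x n))
          }
        ; inverse = (λ x → ≡⇒≈ λ n → ℚ.+-inverseˡ (seq x n))
                  , (λ x → ≡⇒≈ λ n → ℚ.+-inverseʳ (seq x n))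
        ; ⁻¹-cong = neg-cong
        }
      ; comm = λ x y → ≡⇒≈ λ n → ℚ.+-comm (seq x n) (seq y n)
      }
    ; *-cong = *-cong
    ; *-assoc = λ x y z → ≡⇒≈ λ n → ℚ.*-assoc (seq x n) (seq y n) (seq z n)
    ; *-identity = (λ x → ≡⇒≈ λ n → ℚ.*-identityˡ (seq x n))
                 , (λ x → ≡⇒≈ λ n → ℚ.*-identityʳ (seq x n))
    ; distrib = (λ x y z → ≡⇒≈ λ n → ℚ.*-distribˡ-+ (seq x n) (seq y n) (seq z n))
              , (λ x y z → ≡⇒≈ λ n → ℚ.*-distribʳ-+ (seq x n) (seq y n) (seq z n))
    }
  ; *-comm = λ x y → ≡⇒≈ λ n → ℚ.*-comm (seq x n) (seq y n)
  }

ℝ-commutativeRing : CommutativeRing 0ℓ 0ℓ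
ℝ-commutativeRing = record { isCommutativeRing = ℝ-isCommutativeRing }

private
  ℝ-almostCommutativeRing : ACR.AlmostCommutativeRing 0ℓ 0ℓ
  ℝ-almostCommutativeRing = ACR.fromCommutativeRing ℝ-commutativeRing

  -- Equality of reals is not decidable, so the solver takes its coefficients from ℚ, where
  -- constants such as `½` can be computed with and compared.
  fromℚ-homomorphism : ℚ.+-*-rawRing ACR.-Raw-AlmostCommutative⟶ ℝ-almostCommutativeRing
  fromℚ-homomorphism = record
    { ⟦_⟧    = fromℚ
    ; +-homo = λ p q → ≡⇒≈ λ _ → refl
    ; *-homo = λ p q → ≡⇒≈ λ _ → refl
    ; -‿homo = λ p → ≡⇒≈ λ _ → refl
    ; 0-homo = ≡⇒≈ λ _ → refl
    ; 1-homo = ≡⇒≈ λ _ → refl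
    }

  fromℚ-≟ : ∀ p q → Maybe (fromℚ p ≈ fromℚ q)
  fromℚ-≟ p q = Maybe.map (λ { refl → ≈-refl }) (dec⇒maybe (p ℚ.≟ q))

module ℝ-Solver =
  Algebra.Solver.Ring ℚ.+-*-rawRing ℝ-almostCommutativeRing fromℚ-homomorphism fromℚ-≟

open ℝ-Solver using (solve; _:=_; _:+_; _:*_; _:-_; :-_; con)

module R = CommutativeRing ℝ-commutativeRing

-- Order

private
  ½ε : ∀ ε → ε ℚ.- ½ ℚ.* ε ≡ ½ ℚ.* ε
  ½ε ε = trans (cong (ℚ._- ½ ℚ.* ε) (sym (half+half ε))) (cancel (½ ℚ.* ε))
    where
    cancel : ∀ δ → (δ ℚ.+ δ) ℚ.- δ ≡ δ
    cancel = Tactic.RingSolver.solve-∀ ℚring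

  p-[p-q]≡q : ∀ p q → p ℚ.- (p ℚ.- q) ≡ q
  p-[p-q]≡q = Tactic.RingSolver.solve-∀ ℚring

  p≡q-[q-p] : ∀ p q → p ≡ q ℚ.+ ℚ.- (q ℚ.- p)
  p≡q-[q-p] = Tactic.RingSolver.solve-∀ ℚring

  p≤∣p∣ : ∀ p → p ℚ.≤ ℚ.∣ p ∣
  p≤∣p∣ p with ℚ.≤-total 0ℚ p
  ... | inj₁ 0≤p = ℚ.≤-reflexive (sym (ℚ.0≤p⇒∣p∣≡p 0≤p))
  ... | inj₂ p≤0 = ℚ.≤-trans p≤0 (ℚ.0≤∣p∣ p)

  half-bound : ∀ {ε p q} → ε ℚ.≤ p → ℚ.∣ p ℚ.- q ∣ ℚ.< ½ ℚ.* ε → ½ ℚ.* ε ℚ.< q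
  half-bound {ε} {p} {q} ε≤p ∣p-q∣<½ε = subst₂ ℚ._<_ (½ε ε) (p-[p-q]≡q p q)
    (ℚ.+-mono-≤-< ε≤p (ℚ.neg-antimono-< (ℚ.≤-<-trans (p≤∣p∣ (p ℚ.- q)) ∣p-q∣<½ε)))

-- The margin `ε` is uniform in the index: a sequence of positive terms may still represent 0.
record Pos (x : ℝ) : Set where
  constructor mkPos
  field
    {ε}   : ℚ
    0<ε   : 0ℚ ℚ.< ε
    N     : ℕ
    ε<seq : ∀ n → N ℕ.≤ n → ε ℚ.< seq x n

Pos-cong : ∀ {x y} → x ≈ y → Pos x → Pos y
Pos-cong {x} {y} (mk≈ x≃y) (mkPos {ε} 0<ε M ε<x) =
  let (N , ∣x-y∣<½ε) = x≃y (½ ℚ.* ε) (half ε 0<ε)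
  in mkPos (half ε 0<ε) (M ℕ.⊔ N) λ n le →
       half-bound {p = seq x n} {q = seq y n}
         (ℚ.<⇒≤ (ε<x n (ℕ.m⊔n≤o⇒m≤o M N le))) (∣x-y∣<½ε n (ℕ.m⊔n≤o⇒n≤o M N le))

Pos-+ : ∀ {x y} → Pos x → Pos y → Pos (x + y)
Pos-+ (mkPos {ε} 0<ε M ε<x) (mkPos {δ} 0<δ N δ<y) =
  mkPos (ℚ.+-mono-< 0<ε 0<δ) (M ℕ.⊔ N) λ n le →
    ℚ.+-mono-< (ε<x n (ℕ.m⊔n≤o⇒m≤o M N le)) (δ<y n (ℕ.m⊔n≤o⇒n≤o M N le))

Pos-* : ∀ {x y} → Pos x → Pos y → Pos (x * y)
Pos-* {x} {y} (mkPos {ε} 0<ε M ε<x) (mkPos {δ} 0<δ N δ<y) =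
  mkPos (subst (ℚ._< ε ℚ.* δ) (ℚ.*-zeroʳ ε) (ℚ.*-monoʳ-<-pos ε {{ℚ.positive 0<ε}} 0<δ)) (M ℕ.⊔ N) λ n le →
    let ε<xₙ = ε<x n (ℕ.m⊔n≤o⇒m≤o M N le)
        δ<yₙ = δ<y n (ℕ.m⊔n≤o⇒n≤o M N le)
    in ℚ.<-trans (ℚ.*-monoˡ-<-pos δ {{ℚ.positive 0<δ}} ε<xₙ)
                 (ℚ.*-monoʳ-<-pos (seq x n) {{ℚ.positive (ℚ.<-trans 0<ε ε<xₙ)}} δ<yₙ)

Pos-fromℚ : ∀ {p} → 0ℚ ℚ.< p → Pos (fromℚ p)
Pos-fromℚ {p} 0<p = mkPos (half p 0<p) 0 λ _ _ →
  half-bound {p = p} {q = p} ℚ.≤-refl (subst (ℚ._< ½ ℚ.* p) (sym (∣p-p∣≡0 p)) (half p 0<p))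

¬Pos0 : ∀ {x} → x ≈ 0ℝ → ¬ Pos x
¬Pos0 x≈0 p = irreflexive (Pos-cong x≈0 p)
  where
  irreflexive : ¬ Pos 0ℝ
  irreflexive (mkPos {ε} 0<ε N ε<0) = ℚ.<-asym {0ℚ} {ε} 0<ε (ε<0 N ℕ.≤-refl)

Pos-asym : ∀ {x} → Pos x → ¬ Pos (- x)
Pos-asym {x} p q = ¬Pos0 (R.-‿inverseʳ x) (Pos-+ p q)

-- The index comes from the Cauchy modulus, not from the negated hypothesis: if one term past it
-- reached `ε`, all later ones would exceed `½ ε` and `x` would be positive. Terms are rational, so
-- this refutation yields the strict bound.
¬Pos⇒bounded : ∀ {x} → ¬ Pos x → ∀ ε → 0ℚ ℚ.< ε → ∃[ N ] (∀ n → N ℕ.≤ n → seq x n ℚ.< ε)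
¬Pos⇒bounded {x} ¬pos ε 0<ε =
  let (N , ∣xₘ-xₙ∣<½ε) = cauchy x (½ ℚ.* ε) (half ε 0<ε)
  in N , λ n N≤n → ℚ.≰⇒> λ ε≤xₙ → ¬pos (mkPos (half ε 0<ε) N λ m N≤m →
       half-bound {p = seq x n} {q = seq x m} ε≤xₙ (∣xₘ-xₙ∣<½ε n m N≤n N≤m))

¬Pos∧¬Neg⇒≈0 : ∀ {x} → ¬ Pos x → ¬ Pos (- x) → x ≈ 0ℝ
¬Pos∧¬Neg⇒≈0 {x} ¬pos ¬neg = mk≈ λ ε 0<ε →
  let (M , x<ε)  = ¬Pos⇒bounded {x} ¬pos ε 0<ε
      (N , -x<ε) = ¬Pos⇒bounded { - x} ¬neg ε 0<ε
  in M ℕ.⊔ N , λ n le → subst (λ p → ℚ.∣ p ∣ ℚ.< ε) (sym (ℚ.+-identityʳ (seq x n)))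
       (abs< (seq x n) (x<ε n (ℕ.m⊔n≤o⇒m≤o M N le)) (-x<ε n (ℕ.m⊔n≤o⇒n≤o M N le)))
  where
  abs< : ∀ p {ε} → p ℚ.< ε → ℚ.- p ℚ.< ε → ℚ.∣ p ∣ ℚ.< ε
  abs< p {ε} p<ε -p<ε with ℚ.∣p∣≡p∨∣p∣≡-p p
  ... | inj₁ eq = subst (ℚ._< ε) (sym eq) p<ε
  ... | inj₂ eq = subst (ℚ._< ε) (sym eq) -p<ε

trichotomy : ∀ x → ¬ ¬ (Pos x ⊎ x ≈ 0ℝ ⊎ Pos (- x))
trichotomy x k = k (inj₂ (inj₁ (¬Pos∧¬Neg⇒≈0 (λ p → k (inj₁ p)) (λ p → k (inj₂ (inj₂ p))))))

-- Being a negation it is stable, so its proofs may split on `trichotomy`; `NonNeg⇒≤` and `≤⇒NonNeg`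
-- identify it with `_≤_`.
record NonNeg (x : ℝ) : Set where
  constructor mkNonNeg
  field ¬neg : ¬ Pos (- x)

open NonNeg public

NonNeg-stable : ∀ {x} → ¬ ¬ NonNeg x → NonNeg x
NonNeg-stable ¬¬nn = mkNonNeg λ neg → ¬¬nn λ nn → ¬neg nn neg

NonNeg-cong : ∀ {x y} → x ≈ y → NonNeg x → NonNeg y
NonNeg-cong x≈y nn = mkNonNeg λ neg → ¬neg nn (Pos-cong (neg-cong (≈-sym x≈y)) neg)

NonNeg-0 : ∀ {x} → x ≈ 0ℝ → NonNeg x
NonNeg-0 x≈0 = mkNonNeg (¬Pos0 (R.trans (neg-cong x≈0) (solve 0 (:- con 0ℚ := con 0ℚ) ≈-refl)))

Pos⇒NonNeg : ∀ {x} → Pos x → NonNeg x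
Pos⇒NonNeg p = mkNonNeg (Pos-asym p)

NonNeg⇒¬¬ : ∀ {x} → NonNeg x → ¬ ¬ (Pos x ⊎ x ≈ 0ℝ)
NonNeg⇒¬¬ {x} nn k = trichotomy x λ where
  (inj₁ p)        → k (inj₁ p)
  (inj₂ (inj₁ z)) → k (inj₂ z)
  (inj₂ (inj₂ n)) → ¬neg nn n

Pos-+-NonNeg : ∀ {x y} → Pos x → NonNeg y → ¬ ¬ Pos (x + y)
Pos-+-NonNeg {x} {y} p nn k = NonNeg⇒¬¬ nn λ where
  (inj₁ q) → k (Pos-+ p q)
  (inj₂ z) → k (Pos-cong (R.trans (R.sym (R.+-identityʳ x)) (+-cong ≈-refl (≈-sym z))) p)

NonNeg-+ : ∀ {x y} → NonNeg x → NonNeg y → NonNeg (x + y)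
NonNeg-+ {x} {y} p q = mkNonNeg λ neg → Pos-+-NonNeg neg p λ r →
  ¬neg q (Pos-cong (solve 2 (λ x y → :- (x :+ y) :+ x := :- y) ≈-refl x y) r)

NonNeg-* : ∀ {x y} → NonNeg x → NonNeg y → NonNeg (x * y)
NonNeg-* {x} {y} p q = NonNeg-stable λ k → NonNeg⇒¬¬ p λ where
  (inj₂ z) → k (NonNeg-0 (R.trans (*-cong z (≈-refl {y})) (R.zeroˡ y)))
  (inj₁ p) → NonNeg⇒¬¬ q λ where
    (inj₂ z) → k (NonNeg-0 (R.trans (*-cong (≈-refl {x}) z) (R.zeroʳ x)))
    (inj₁ q) → k (Pos⇒NonNeg (Pos-* p q))

NonNeg-square : ∀ x → NonNeg (x * x)
NonNeg-square x = NonNeg-stable λ k → trichotomy x λ where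
  (inj₁ p)        → k (Pos⇒NonNeg (Pos-* p p))
  (inj₂ (inj₁ z)) → k (NonNeg-0 (R.trans (*-cong z (≈-refl {x})) (R.zeroˡ x)))
  (inj₂ (inj₂ n)) → k (Pos⇒NonNeg (Pos-cong (solve 1 (λ x → (:- x) :* (:- x) := x :* x) ≈-refl x) (Pos-* n n)))

square≈0 : ∀ {x} → ¬ Pos (x * x) → x ≈ 0ℝ
square≈0 {x} ¬pos = ¬Pos∧¬Neg⇒≈0 (λ p → ¬pos (Pos-* p p))
  (λ n → ¬pos (Pos-cong (solve 1 (λ x → (:- x) :* (:- x) := x :* x) ≈-refl x) (Pos-* n n)))

NonNeg-cancel : ∀ {x y} → Pos x → NonNeg (x * y) → NonNeg y
NonNeg-cancel {x} {y} p nn = mkNonNeg λ neg →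
  ¬neg nn (Pos-cong (solve 2 (λ x y → x :* (:- y) := :- (x :* y)) ≈-refl x y) (Pos-* p neg))

-- Squares spare the signs: if x² > 0, then y² > 0 is impossible because x² y² = 0.
x*y≈0⇒ : ∀ {x y} → x * y ≈ 0ℝ → ¬ ¬ (x ≈ 0ℝ ⊎ y ≈ 0ℝ)
x*y≈0⇒ {x} {y} xy≈0 k = square-split λ where
    (inj₁ p) → k (inj₂ (square≈0 λ q → ¬Pos0 x²y²≈0 (Pos-* p q)))
    (inj₂ z) → k (inj₁ (square≈0 (¬Pos0 z)))
  where
  square-split : ¬ ¬ (Pos (x * x) ⊎ x * x ≈ 0ℝ)
  square-split = NonNeg⇒¬¬ (NonNeg-square x)
  x²y²≈0 : (x * x) * (y * y) ≈ 0ℝ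
  x²y²≈0 = R.trans (solve 2 (λ x y → (x :* x) :* (y :* y) := (x :* y) :* (x :* y)) ≈-refl x y)
             (R.trans (*-cong xy≈0 (≈-refl {x * y})) (R.zeroˡ (x * y)))

NonNeg⇒≤ : ∀ {x y} → NonNeg (y - x) → x ≤ y
NonNeg⇒≤ {x} {y} nn ε 0<ε =
  let (N , x-y<ε) = ¬Pos⇒bounded { - (y - x)} (¬neg nn) ε 0<ε
  in N , λ n N≤n → subst (ℚ._< seq y n ℚ.+ ε) (sym (p≡q-[q-p] (seq x n) (seq y n)))
       (ℚ.+-monoʳ-< (seq y n) (x-y<ε n N≤n))

≤⇒NonNeg : ∀ {x y} → x ≤ y → NonNeg (y - x)
≤⇒NonNeg {x} {y} x≤y = mkNonNeg λ where
  (mkPos {ε} 0<ε M ε<x-y) →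
    let (N , x<y+ε) = x≤y ε 0<ε
        n = M ℕ.⊔ N
    in ℚ.<-asym (x<y+ε n (ℕ.m≤n⊔m M N))
         (subst (seq y n ℚ.+ ε ℚ.<_) (sym (p≡q-[q-p] (seq x n) (seq y n)))
           (ℚ.+-monoʳ-< (seq y n) (ε<x-y n (ℕ.m≤m⊔n M N))))

step : ℕ → ℝ
step k = fromℚ (+ 1 ℚ./ suc k)

Pos-step : ∀ k → Pos (step k)
Pos-step k = Pos-fromℚ (/-cross-< 0 1 0 k (ℕ.s≤s ℕ.z≤n))

-- The constant 2 leaves a strict gap even at `k = 0`, where the step is 1, so a comparison of
-- rationals by `<` suffices.
step≤2 : ∀ k → NonNeg (fromℕ 2 - step k)
step≤2 k = Pos⇒NonNeg (Pos-cong (≡⇒≈ λ _ → refl)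
  (Pos-fromℚ (subst (ℚ._< + 2 ℚ./ 1 ℚ.- + 1 ℚ./ suc k) (ℚ.+-inverseʳ (+ 1 ℚ./ suc k))
    (ℚ.+-monoˡ-< (ℚ.- (+ 1 ℚ./ suc k)) (/-cross-< 1 2 k 0 1<2+2k)))))
  where
  1<2+2k : 1 ℕ.< 2 ℕ.* suc k
  1<2+2k = ℕ.s≤s (ℕ.≤-trans (ℕ.s≤s ℕ.z≤n) (ℕ.m≤n+m (1 ℕ.* suc k) k))

-- The Archimedean property in the form that limits use: a positive number outweighs an error
-- proportional to `step k`. Half of the margin of `x` is spent on the error, with an eventual bound
-- of `y` fixing `k`.
step-small : ∀ {x} → Pos x → ∀ y → ∃[ k ] Pos (x - step k * y)
step-small {x} (mkPos {ε} 0<ε M ε<x) y =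
  let (B , N , 0<B , ∣y∣≤B) = eventually-bounded y
      (δ , 0<δ , Bδ≡½ε)     = scaled-tolerance B (½ ℚ.* ε) 0<B (half ε 0<ε)
      (k , step<δ)          = archimedean δ 0<δ
      s = + 1 ℚ./ suc k
      instance _ = ℚ.positive {s} (/-cross-< 0 1 0 k (ℕ.s≤s ℕ.z≤n))
  in k , mkPos (half ε 0<ε) (M ℕ.⊔ N) λ n le →
    let open ℚ.≤-Reasoning
        s*y<½ε : s ℚ.* seq y n ℚ.< ½ ℚ.* ε
        s*y<½ε = begin-strict
          s ℚ.* seq y n  ≤⟨ ℚ.*-monoˡ-≤-nonNeg s {{ℚ.pos⇒nonNeg s}}
                              (ℚ.≤-trans (p≤∣p∣ (seq y n)) (∣y∣≤B n (ℕ.m⊔n≤o⇒n≤o M N le))) ⟩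
          s ℚ.* B        <⟨ ℚ.*-monoˡ-<-pos B {{ℚ.positive 0<B}} (step<δ k ℕ.≤-refl) ⟩
          δ ℚ.* B        ≡⟨ ℚ.*-comm δ B ⟩
          B ℚ.* δ        ≡⟨ Bδ≡½ε ⟩
          ½ ℚ.* ε        ∎
    in subst (ℚ._< seq x n ℚ.- s ℚ.* seq y n) (½ε ε)
         (ℚ.+-mono-< (ε<x n (ℕ.m⊔n≤o⇒m≤o M N le)) (ℚ.neg-antimono-< s*y<½ε))

-- Determinants

module ∑ = Algebra.Properties.CommutativeMonoid.Sum R.+-commutativeMonoid
module ∑* = Algebra.Properties.Semiring.Sum R.semiring
module ∏ = Algebra.Properties.CommutativeMonoid.Sum R.*-commutativeMonoid

open Relation.Binary.Reasoning.Setoid R.setoid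

∑-zero : {x : Vector ℝ m} → (∀ i → x i ≈ 0ℝ) → ∑ x ≈ 0ℝ
∑-zero {m} x≈0 = R.trans (∑.sum-cong-≋ x≈0) (∑.sum-replicate-zero m)

alternate-cong : ∀ k {x y} → x ≈ y → alternate k x ≈ alternate k y
alternate-cong zero    x≈y = x≈y
alternate-cong (suc k) x≈y = neg-cong (alternate-cong k x≈y)

alternate-+ : ∀ k x y → alternate k (x + y) ≈ alternate k x + alternate k y
alternate-+ zero    x y = ≈-refl
alternate-+ (suc k) x y = R.trans (neg-cong (alternate-+ k x y))
  (solve 2 (λ x y → :- (x :+ y) := :- x :+ :- y) ≈-refl (alternate k x) (alternate k y))

alternate-* : ∀ k x y → alternate k (x * y) ≈ x * alternate k y
alternate-* zero    x y = ≈-refl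
alternate-* (suc k) x y = R.trans (neg-cong (alternate-* k x y))
  (solve 2 (λ x y → :- (x :* y) := x :* :- y) ≈-refl x (alternate k y))

alternate-neg : ∀ k x → alternate k (- x) ≈ - alternate k x
alternate-neg zero    x = ≈-refl
alternate-neg (suc k) x = neg-cong (alternate-neg k x)

alternate-0 : ∀ k {x} → x ≈ 0ℝ → alternate k x ≈ 0ℝ
alternate-0 zero    x≈0 = x≈0
alternate-0 (suc k) x≈0 = R.trans (neg-cong (alternate-0 k x≈0))
  (solve 0 (:- con 0ℚ := con 0ℚ) ≈-refl)

minor : Matrix (suc m) → Fin (suc m) → Matrix m
minor X j i = removeAt (X (Fin.suc i)) j

det-cong : {X Y : Matrix m} → (∀ i j → X i j ≈ Y i j) → det X ≈ det Y
det-cong {zero}  X≈Y = ≈-refl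
det-cong {suc m} X≈Y = ∑.sum-cong-≋ λ j → alternate-cong (toℕ j)
  (*-cong (X≈Y Fin.zero j) (det-cong λ i k → X≈Y (Fin.suc i) (punchIn j k)))

-- Expansion of a determinant along two rows x and y; F j k is the minor
-- left when column j is deleted first and then column k of the remainder.
expand₂ : (Fin (suc m) → Fin m → ℝ) → Vector ℝ (suc m) → Vector ℝ (suc m) → ℝ
expand₂ F x y = ∑ λ j → alternate (toℕ j)
  (x j * ∑ λ k → alternate (toℕ k) (removeAt y j k * F j k))

-- F does not depend on the order in which the two columns are deleted.
OrderFree : (Fin (suc m) → Fin m → ℝ) → Set
OrderFree {zero}  F = ⊤
OrderFree {suc m} F = (∀ j → F Fin.zero j ≈ F (Fin.suc j) Fin.zero) ×
                      OrderFree (λ j k → F (Fin.suc j) (Fin.suc k))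

orderFree-cong : {F G : Fin (suc m) → Fin m → ℝ} → (∀ j k → F j k ≈ G j k) →
                 OrderFree F → OrderFree G
orderFree-cong {zero}  F≈G _       = tt
orderFree-cong {suc m} F≈G (p , q) =
  (λ j → R.trans (R.sym (F≈G Fin.zero j)) (R.trans (p j) (F≈G (Fin.suc j) Fin.zero))) ,
  orderFree-cong (λ j k → F≈G (Fin.suc j) (Fin.suc k)) q

-- The statement is about index maps `κ` and arbitrary `T` so that the induction can keep column 0
-- in front and absorb it into `T`. `T-cong` stands in for function extensionality.
orderFree-removeAt : {I : Set} (T : Vector I m → ℝ) → (∀ κ κ′ → κ ≗ κ′ → T κ ≈ T κ′) →
  (κ : Vector I (suc (suc m))) → OrderFree (λ j k → T (removeAt (removeAt κ j) k))
orderFree-removeAt {zero}  T T-cong κ = (λ _ → T-cong _ _ λ ()) , tt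
orderFree-removeAt {suc m} T T-cong κ =
  (λ _ → ≈-refl) ,
  orderFree-cong
    (λ j k → T-cong (head κ ∷ removeAt (removeAt (tail κ) j) k) (removeAt (removeAt κ (Fin.suc j)) (Fin.suc k))
      λ { Fin.zero → refl ; (Fin.suc _) → refl })
    (orderFree-removeAt (λ κ′ → T (head κ ∷ κ′))
      (λ κ₁ κ₂ κ₁≗κ₂ → T-cong (head κ ∷ κ₁) (head κ ∷ κ₂)
        λ { Fin.zero → refl ; (Fin.suc i) → κ₁≗κ₂ i })
      (tail κ))

-- Induction on the columns: the terms in which one of the rows uses column 0 add up to
-- `x₀ * P y - y₀ * P x`, which changes sign with the rows, and the others form the same expansion
-- over the remaining columns.
expand₂-antisym : (F : Fin (suc m) → Fin m → ℝ) → OrderFree F → (x y : Vector ℝ (suc m)) →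
                  expand₂ F x y + expand₂ F y x ≈ 0ℝ
expand₂-antisym {zero} F _ x y =
  solve 2 (λ a b → (a :* con 0ℚ :+ con 0ℚ) :+ (b :* con 0ℚ :+ con 0ℚ) := con 0ℚ)
    ≈-refl (x Fin.zero) (y Fin.zero)
expand₂-antisym {suc m} F (F-sym , F′-free) x y = begin
  expand₂ F x y + expand₂ F y x
    ≈⟨ +-cong (split x y) (split y x) ⟩
  (x₀ * P y + (- (y₀ * P x) + expand₂ F′ (tail x) (tail y))) +
  (y₀ * P x + (- (x₀ * P y) + expand₂ F′ (tail y) (tail x)))
    ≈⟨ solve 4 (λ a b c d → (a :+ (:- b :+ c)) :+ (b :+ (:- a :+ d)) := c :+ d) ≈-refl
         (x₀ * P y) (y₀ * P x) (expand₂ F′ (tail x) (tail y)) (expand₂ F′ (tail y) (tail x)) ⟩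
  expand₂ F′ (tail x) (tail y) + expand₂ F′ (tail y) (tail x)
    ≈⟨ expand₂-antisym F′ F′-free (tail x) (tail y) ⟩
  0ℝ ∎
  where
  x₀ y₀ : ℝ
  x₀ = x Fin.zero
  y₀ = y Fin.zero

  F′ : Fin (suc m) → Fin m → ℝ
  F′ j k = F (Fin.suc j) (Fin.suc k)

  P : Vector ℝ (suc (suc m)) → ℝ
  P z = ∑ λ k → alternate (toℕ k) (z (Fin.suc k) * F Fin.zero k)

  module _ (x y : Vector ℝ (suc (suc m))) where
    inner : Fin (suc m) → ℝ
    inner j = ∑ λ k → alternate (toℕ k) (removeAt (tail y) j k * F′ j k)

    inner-neg : ∀ j → (∑ λ k → - alternate (toℕ k) (removeAt (tail y) j k * F′ j k)) ≈ - inner j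
    inner-neg j = ∑-neg λ k → alternate (toℕ k) (removeAt (tail y) j k * F′ j k)
      where
      ∑-neg : ∀ {n} (z : Vector ℝ n) → (∑ λ k → - z k) ≈ - ∑ z
      ∑-neg {zero}  z = solve 0 (con 0ℚ := :- con 0ℚ) ≈-refl
      ∑-neg {suc n} z = R.trans (+-cong ≈-refl (∑-neg (tail z)))
        (solve 2 (λ a b → :- a :+ :- b := :- (a :+ b)) ≈-refl (head z) (∑ (tail z)))

    -- Passing to the tails shifts both column indices by one. The two signs cancel in the inner
    -- expansion, while the column 0 term keeps one of them.
    summand : ∀ j →
      - alternate (toℕ j) (x (Fin.suc j) *
          (y Fin.zero * F (Fin.suc j) Fin.zero +
           (∑ λ k → - alternate (toℕ k) (removeAt (tail y) j k * F′ j k)))) ≈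
      (- y Fin.zero) * alternate (toℕ j) (x (Fin.suc j) * F Fin.zero j) +
      alternate (toℕ j) (x (Fin.suc j) * inner j)
    summand j = begin
      - alternate (toℕ j) (p * (q * F (Fin.suc j) Fin.zero +
           (∑ λ k → - alternate (toℕ k) (removeAt (tail y) j k * F′ j k))))
        ≈⟨ neg-cong (alternate-cong (toℕ j) (*-cong ≈-refl
             (+-cong (*-cong ≈-refl (R.sym (F-sym j))) (inner-neg j)))) ⟩
      - alternate (toℕ j) (p * (q * r + - inner j))
        ≈⟨ alternate-neg (toℕ j) (p * (q * r + - inner j)) ⟨
      alternate (toℕ j) (- (p * (q * r + - inner j)))
        ≈⟨ alternate-cong (toℕ j)
             (solve 4 (λ p q r s → :- (p :* (q :* r :+ :- s)) := (:- q) :* (p :* r) :+ p :* s)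
               ≈-refl p q r (inner j)) ⟩
      alternate (toℕ j) ((- q) * (p * r) + p * inner j)
        ≈⟨ alternate-+ (toℕ j) ((- q) * (p * r)) (p * inner j) ⟩
      alternate (toℕ j) ((- q) * (p * r)) + alternate (toℕ j) (p * inner j)
        ≈⟨ +-cong (alternate-* (toℕ j) (- q) (p * r)) ≈-refl ⟩
      (- q) * alternate (toℕ j) (p * r) + alternate (toℕ j) (p * inner j) ∎
      where
      p q r : ℝ
      p = x (Fin.suc j)
      q = y Fin.zero
      r = F Fin.zero j

    split : expand₂ F x y ≈
            x Fin.zero * P y + (- (y Fin.zero * P x) + expand₂ F′ (tail x) (tail y))
    split = +-cong ≈-refl (begin
      _ ≈⟨ ∑.sum-cong-≋ summand ⟩
      _ ≈⟨ ∑.∑-distrib-+ (λ j → (- y Fin.zero) * alternate (toℕ j) (x (Fin.suc j) * F Fin.zero j))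
                         (λ j → alternate (toℕ j) (x (Fin.suc j) * inner j)) ⟩
      _ ≈⟨ +-cong (R.sym (∑*.*-distribˡ-sum (- y Fin.zero)
                    (λ j → alternate (toℕ j) (x (Fin.suc j) * F Fin.zero j)))) ≈-refl ⟩
      (- y Fin.zero) * P x + expand₂ F′ (tail x) (tail y)
        ≈⟨ +-cong (solve 2 (λ a b → (:- a) :* b := :- (a :* b)) ≈-refl (y Fin.zero) (P x)) ≈-refl ⟩
      - (y Fin.zero * P x) + expand₂ F′ (tail x) (tail y) ∎)

swapTop : Matrix (suc (suc m)) → Matrix (suc (suc m))
swapTop X = X (Fin.suc Fin.zero) ∷ X Fin.zero ∷ λ i → X (Fin.suc (Fin.suc i))

-- Both determinants are instances of `expand₂` by definition, with `F` the minors of the rows below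
-- the top two; such a minor depends only on which columns remain.
det-swapTop : (X : Matrix (suc (suc m))) → det X + det (swapTop X) ≈ 0ℝ
det-swapTop X = expand₂-antisym
  (λ j k → det λ i → removeAt (removeAt (X (Fin.suc (Fin.suc i))) j) k)
  (orderFree-removeAt (λ κ → det λ i l → X (Fin.suc (Fin.suc i)) (κ l))
    (λ _ _ κ≗κ′ → det-cong λ i l → R.reflexive (≡.cong (X (Fin.suc (Fin.suc i))) (κ≗κ′ l)))
    (λ i → i))
  (X Fin.zero) (X (Fin.suc Fin.zero))

-- If the equal rows are the top two, the swap fixes the matrix and negates its determinant.
-- Otherwise the swap moves the first copy into row 1, and every minor along the new top row again
-- has a repeated first row.
det-repeatedRow : (X : Matrix (suc m)) (i : Fin m) → (∀ j → X Fin.zero j ≈ X (Fin.suc i) j) →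
                  det X ≈ 0ℝ
det-repeatedRow {suc m} X Fin.zero x₀≈x₁ = begin
  det X                           ≈⟨ solve 1 (λ a → a := con ½ :* (a :+ a)) ≈-refl (det X) ⟩
  fromℚ ½ * (det X + det X)       ≈⟨ *-cong ≈-refl (+-cong ≈-refl (det-cong swapped)) ⟩
  fromℚ ½ * (det X + det (swapTop X)) ≈⟨ *-cong ≈-refl (det-swapTop X) ⟩
  fromℚ ½ * 0ℝ                    ≈⟨ R.zeroʳ (fromℚ ½) ⟩
  0ℝ                              ∎
  where
  swapped : ∀ i j → X i j ≈ swapTop X i j
  swapped Fin.zero              j = x₀≈x₁ j
  swapped (Fin.suc Fin.zero)    j = R.sym (x₀≈x₁ j)
  swapped (Fin.suc (Fin.suc _)) j = ≈-refl
det-repeatedRow {suc m} X (Fin.suc i) x₀≈xᵢ = begin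
  det X                                 ≈⟨ R.+-identityʳ (det X) ⟨
  det X + 0ℝ                            ≈⟨ +-cong ≈-refl (∑-zero minors-vanish) ⟨
  det X + det (swapTop X)               ≈⟨ det-swapTop X ⟩
  0ℝ                                    ∎
  where
  minors-vanish : ∀ j → alternate (toℕ j) (swapTop X Fin.zero j * det (minor (swapTop X) j)) ≈ 0ℝ
  minors-vanish j = alternate-0 (toℕ j) (R.trans
    (*-cong (≈-refl {swapTop X Fin.zero j}) (det-repeatedRow (minor (swapTop X) j) i (λ k → x₀≈xᵢ (punchIn j k))))
    (R.zeroʳ (swapTop X Fin.zero j)))

-- First-row cofactors and the characteristic matrix

cofactors : Matrix (suc m) → Vector ℝ (suc m)
cofactors X j = alternate (toℕ j) (det (minor X j))

infix 7 _·_
_·_ : Vector ℝ m → Vector ℝ m → ℝ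
x · y = ∑ λ i → x i * y i

det-row₀ : (X : Matrix (suc m)) → X Fin.zero · cofactors X ≈ det X
det-row₀ X = ∑.sum-cong-≋ λ j →
  R.sym (alternate-* (toℕ j) (X Fin.zero j) (det (minor X j)))

-- The cofactors do not see the top row, so the pairing is the determinant of `X` with a lower row
-- copied to the top.
row-cofactors : (X : Matrix (suc m)) (i : Fin m) → X (Fin.suc i) · cofactors X ≈ 0ℝ
row-cofactors X i = R.trans (det-row₀ Y) (det-repeatedRow Y i λ _ → ≈-refl)
  where
  Y : Matrix _
  Y = X (Fin.suc i) ∷ tail X

diagonal-on : (v : Vector ℝ m) (i : Fin m) → diagonal v i i ≡ v i
diagonal-on v i = ≡.cong (if_then v i else 0ℝ) (dec-true (i Fin.≟ i) refl)

diagonal-off : (v : Vector ℝ m) {i j : Fin m} → ¬ i ≡ j → diagonal v i j ≡ 0ℝ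
diagonal-off v {i} {j} i≢j = ≡.cong (if_then v i else 0ℝ) (dec-false (i Fin.≟ j) i≢j)

diagonal-· : (v x : Vector ℝ m) (i : Fin m) → diagonal v i · x ≈ v i * x i
diagonal-· {suc m} v x i = begin
  diagonal v i · x
    ≈⟨ ∑.sum-remove {i = i} (λ j → diagonal v i j * x j) ⟩
  diagonal v i i * x i + ∑ (removeAt (λ j → diagonal v i j * x j) i)
    ≈⟨ +-cong (*-cong (R.reflexive (diagonal-on v i)) ≈-refl) (∑-zero λ j →
         R.trans (*-cong (R.reflexive (diagonal-off v λ i≡ → Fin.punchInᵢ≢i i j (≡.sym i≡))) ≈-refl)
                 (R.zeroˡ (x (punchIn i j)))) ⟩
  v i * x i + 0ℝ
    ≈⟨ R.+-identityʳ (v i * x i) ⟩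
  v i * x i ∎

charMatrix : Matrix m → ℝ → Matrix m
charMatrix X t = diagonal (λ _ → t) -ᴹ X

Symmetric : Matrix m → Set
Symmetric X = ∀ i j → X i j ≈ X j i

≟-swap : (i j : Fin m) → does (i Fin.≟ j) ≡ does (j Fin.≟ i)
≟-swap i j with j Fin.≟ i
... | yes j≡i = dec-true (i Fin.≟ j) (≡.sym j≡i)
... | no  j≢i = dec-false (i Fin.≟ j) λ i≡j → j≢i (≡.sym i≡j)

diagonal-sym : (t : ℝ) → Symmetric {m} (diagonal λ _ → t)
diagonal-sym t i j = R.reflexive (≡.cong (if_then t else 0ℝ) (≟-swap i j))

charMatrix-sym : {X : Matrix m} → Symmetric X → ∀ t → Symmetric (charMatrix X t)
charMatrix-sym X-sym t i j = +-cong (diagonal-sym t i j) (neg-cong (X-sym i j))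

bilinear : Matrix m → Vector ℝ m → Vector ℝ m → ℝ
bilinear X x y = ∑ λ i → x i * (X i · y)

-- `charMatrix X s` sends its own first-row cofactors to a multiple of the first unit vector, so
-- only entry 0 of the weights survives.
bilinear-cofactors : (X : Matrix (suc m)) → ∀ s t →
  bilinear (charMatrix X s) (cofactors (charMatrix X t)) (cofactors (charMatrix X s)) ≈
  cofactors (charMatrix X t) Fin.zero * charPoly X s
bilinear-cofactors X s t = begin
  (∑ λ i → α i * (A i · β))
    ≈⟨ +-cong (*-cong (≈-refl {α Fin.zero}) (det-row₀ A))
              (∑-zero λ i → R.trans (*-cong (≈-refl {α (Fin.suc i)}) (row-cofactors A i)) (R.zeroʳ (α (Fin.suc i)))) ⟩
  α Fin.zero * charPoly X s + 0ℝ
    ≈⟨ R.+-identityʳ (α Fin.zero * charPoly X s) ⟩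
  α Fin.zero * charPoly X s ∎
  where
  A : Matrix _
  A = charMatrix X s
  α β : Vector ℝ _
  α = cofactors (charMatrix X t)
  β = cofactors A

bilinear-sym : (X : Matrix m) → Symmetric X → ∀ x y → bilinear X x y ≈ bilinear X y x
bilinear-sym X X-sym x y = begin
  bilinear X x y
    ≈⟨ ∑.sum-cong-≋ (λ i → ∑*.*-distribˡ-sum (x i) λ j → X i j * y j) ⟩
  (∑ λ i → ∑ λ j → x i * (X i j * y j))
    ≈⟨ ∑.∑-comm (λ i j → x i * (X i j * y j)) ⟩
  (∑ λ j → ∑ λ i → x i * (X i j * y j))
    ≈⟨ ∑.sum-cong-≋ (λ j → ∑.sum-cong-≋ λ i → R.trans
         (*-cong (≈-refl {x i}) (*-cong (X-sym i j) (≈-refl {y j})))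
         (solve 3 (λ a b c → a :* (b :* c) := c :* (b :* a)) ≈-refl (x i) (X j i) (y j))) ⟩
  (∑ λ j → ∑ λ i → y j * (X j i * x i))
    ≈⟨ ∑.sum-cong-≋ (λ i → ∑*.*-distribˡ-sum (y i) λ j → X i j * x j) ⟨
  bilinear X y x ∎

∑-scale-sub : (c : ℝ) (x y : Vector ℝ m) → (∑ λ i → c * x i - y i) ≈ c * ∑ x - ∑ y
∑-scale-sub {zero}  c x y = solve 1 (λ c → con 0ℚ := c :* con 0ℚ :- con 0ℚ) ≈-refl c
∑-scale-sub {suc m} c x y = R.trans (+-cong ≈-refl (∑-scale-sub c (tail x) (tail y)))
  (solve 5 (λ c a b d e → (c :* a :- b) :+ (c :* d :- e) := c :* (a :+ d) :- (b :+ e)) ≈-refl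
    c (head x) (head y) (∑ (tail x)) (∑ (tail y)))

charMatrix-row : (X : Matrix m) (t : ℝ) (i : Fin m) (y : Vector ℝ m) →
                 charMatrix X t i · y ≈ t * y i - X i · y
charMatrix-row X t i y = begin
  charMatrix X t i · y
    ≈⟨ ∑.sum-cong-≋ (λ j → solve 3 (λ d x y → (d :- x) :* y := con 1ℚ :* (d :* y) :- x :* y) ≈-refl
         (diagonal (λ _ → t) i j) (X i j) (y j)) ⟩
  (∑ λ j → 1ℝ * (diagonal (λ _ → t) i j * y j) - X i j * y j)
    ≈⟨ ∑-scale-sub 1ℝ (λ j → diagonal (λ _ → t) i j * y j) (λ j → X i j * y j) ⟩
  1ℝ * (diagonal (λ _ → t) i · y) - X i · y
    ≈⟨ +-cong (R.trans (R.*-identityˡ (diagonal (λ _ → t) i · y)) (diagonal-· (λ _ → t) y i)) ≈-refl ⟩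
  t * y i - X i · y ∎

bilinear-sub : (X : Matrix m) → ∀ s t x y →
  bilinear (charMatrix X t) x y - bilinear (charMatrix X s) x y ≈ (t - s) * (x · y)
bilinear-sub X s t x y = begin
  bilinear (charMatrix X t) x y - bilinear (charMatrix X s) x y
    ≈⟨ +-cong (bilinear-split t) (neg-cong (bilinear-split s)) ⟩
  (t * (x · y) - bilinear X x y) - (s * (x · y) - bilinear X x y)
    ≈⟨ solve 4 (λ t s d b → (t :* d :- b) :- (s :* d :- b) := (t :- s) :* d) ≈-refl
         t s (x · y) (bilinear X x y) ⟩
  (t - s) * (x · y) ∎
  where
  bilinear-split : ∀ t → bilinear (charMatrix X t) x y ≈ t * (x · y) - bilinear X x y
  bilinear-split t = begin
    bilinear (charMatrix X t) x y
      ≈⟨ ∑.sum-cong-≋ (λ i → *-cong (≈-refl {x i}) (charMatrix-row X t i y)) ⟩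
    (∑ λ i → x i * (t * y i - X i · y))
      ≈⟨ ∑.sum-cong-≋ (λ i → solve 4 (λ a t b c → a :* (t :* b :- c) := t :* (a :* b) :- a :* c)
           ≈-refl (x i) t (y i) (X i · y)) ⟩
    (∑ λ i → t * (x i * y i) - x i * (X i · y))
      ≈⟨ ∑-scale-sub t (λ i → x i * y i) (λ i → x i * (X i · y)) ⟩
    t * (x · y) - bilinear X x y ∎

-- Weighing the equation (sI − X) b = det(sI − X) e₁ by a, where b and a are the
-- first-row cofactors at s and at t, and exchanging s and t.
charPoly-cofactors : (X : Matrix (suc m)) → Symmetric X → ∀ s t →
  let α = cofactors (charMatrix X t)
      β = cofactors (charMatrix X s)
  in β Fin.zero * charPoly X t - α Fin.zero * charPoly X s ≈ (t - s) * (α · β)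
charPoly-cofactors X X-sym s t = begin
  β Fin.zero * charPoly X t - α Fin.zero * charPoly X s
    ≈⟨ +-cong (bilinear-cofactors X t s) (neg-cong (bilinear-cofactors X s t)) ⟨
  bilinear (charMatrix X t) β α - bilinear (charMatrix X s) α β
    ≈⟨ +-cong (bilinear-sym (charMatrix X t) (charMatrix-sym X-sym t) β α) ≈-refl ⟩
  bilinear (charMatrix X t) α β - bilinear (charMatrix X s) α β
    ≈⟨ bilinear-sub X s t α β ⟩
  (t - s) * (α · β) ∎
  where
  α β : Vector ℝ _
  α = cofactors (charMatrix X t)
  β = cofactors (charMatrix X s)

-- The perturbation lowers the entry (0, 0) of tI - X by 1 and changes nothing else; the first-row
-- cofactors stay the same, and the determinant is linear in the top row.
charPoly-perturb : (X : Matrix (suc m)) (t : ℝ) →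
  charPoly (X -ᴹ diagonal (firstEntry (- 1ℝ))) t ≈
  charPoly X t - cofactors (charMatrix X t) Fin.zero
charPoly-perturb {m} X t = begin
  charPoly Y t
    ≈⟨ det-row₀ (charMatrix Y t) ⟨
  charMatrix Y t Fin.zero · cofactors (charMatrix Y t)
    ≈⟨ +-cong (*-cong head-entry (≈-refl {c′ Fin.zero})) (∑.sum-cong-≋ λ j →
         *-cong (tail-entry j) (cofactor-cong (Fin.suc j))) ⟩
  (A Fin.zero Fin.zero - 1ℝ) * c′ Fin.zero +
    (∑ λ j → A Fin.zero (Fin.suc j) * c (Fin.suc j))
    ≈⟨ +-cong (*-cong ≈-refl (cofactor-cong Fin.zero)) ≈-refl ⟩
  (A Fin.zero Fin.zero - 1ℝ) * c Fin.zero +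
    (∑ λ j → A Fin.zero (Fin.suc j) * c (Fin.suc j))
    ≈⟨ solve 3 (λ a c r → (a :- con 1ℚ) :* c :+ r := (a :* c :+ r) :- c) ≈-refl
         (A Fin.zero Fin.zero) (c Fin.zero) (∑ λ j → A Fin.zero (Fin.suc j) * c (Fin.suc j)) ⟩
  (A Fin.zero · c) - c Fin.zero
    ≈⟨ +-cong (det-row₀ A) ≈-refl ⟩
  charPoly X t - c Fin.zero ∎
  where
  Y A : Matrix (suc m)
  Y = X -ᴹ diagonal (firstEntry (- 1ℝ))
  A = charMatrix X t

  c c′ : Vector ℝ (suc m)
  c  = cofactors A
  c′ = cofactors (charMatrix Y t)

  head-entry : charMatrix Y t Fin.zero Fin.zero ≈ A Fin.zero Fin.zero - 1ℝ
  head-entry = solve 2 (λ t x → t :- (x :- (:- con 1ℚ)) := t :- x :- con 1ℚ) ≈-refl t (X Fin.zero Fin.zero)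

  zero-entry : ∀ d x → d - (x - 0ℝ) ≈ d - x
  zero-entry = solve 2 (λ d x → d :- (x :- con 0ℚ) := d :- x) ≈-refl

  tail-entry : ∀ j → charMatrix Y t Fin.zero (Fin.suc j) ≈ A Fin.zero (Fin.suc j)
  tail-entry j = zero-entry 0ℝ (X Fin.zero (Fin.suc j))

  lower-entry : ∀ i j → charMatrix Y t (Fin.suc i) j ≈ A (Fin.suc i) j
  lower-entry i j with Fin.suc i Fin.≟ j
  ... | yes _ = zero-entry t (X (Fin.suc i) j)
  ... | no  _ = zero-entry 0ℝ (X (Fin.suc i) j)

  cofactor-cong : ∀ j → c′ j ≈ c j
  cofactor-cong j = alternate-cong (toℕ j) (det-cong λ i k → lower-entry i (punchIn j k))

-- Scaling, the identity matrix and zero rows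

∏-const : ℝ → ℕ → ℝ
∏-const u m = ∏ {m} λ _ → u

det-scale : (u : ℝ) (X : Matrix m) → det (λ i j → u * X i j) ≈ ∏-const u m * det X
det-scale {zero}  u X = R.sym (R.*-identityˡ 1ℝ)
det-scale {suc m} u X = begin
  (∑ λ j → alternate (toℕ j) (u * X Fin.zero j * det (λ i k → u * minor X j i k)))
    ≈⟨ ∑.sum-cong-≋ (λ j → alternate-cong (toℕ j) (begin
         u * X Fin.zero j * det (λ i k → u * minor X j i k)
           ≈⟨ *-cong (≈-refl {u * X Fin.zero j}) (det-scale u (minor X j)) ⟩
         u * X Fin.zero j * (∏-const u m * det (minor X j))
           ≈⟨ solve 4 (λ u x p d → u :* x :* (p :* d) := u :* p :* (x :* d)) ≈-refl
                u (X Fin.zero j) (∏-const u m) (det (minor X j)) ⟩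
         u * ∏-const u m * (X Fin.zero j * det (minor X j)) ∎)) ⟩
  (∑ λ j → alternate (toℕ j) (u * ∏-const u m * (X Fin.zero j * det (minor X j))))
    ≈⟨ ∑.sum-cong-≋ (λ j → alternate-* (toℕ j) (u * ∏-const u m) (X Fin.zero j * det (minor X j))) ⟩
  (∑ λ j → u * ∏-const u m * alternate (toℕ j) (X Fin.zero j * det (minor X j)))
    ≈⟨ ∑*.*-distribˡ-sum (u * ∏-const u m) (λ j → alternate (toℕ j) (X Fin.zero j * det (minor X j))) ⟨
  u * ∏-const u m * det X ∎

det-identity : ∀ m → det {m} (diagonal λ _ → 1ℝ) ≈ 1ℝ
det-identity zero    = ≈-refl
det-identity (suc m) = begin
  1ℝ * det {m} (diagonal λ _ → 1ℝ) + (∑ λ j → alternate (toℕ (Fin.suc j)) (0ℝ * det (minor I (Fin.suc j))))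
    ≈⟨ +-cong (*-cong (≈-refl {1ℝ}) (det-identity m))
              (∑-zero λ j → alternate-0 (toℕ (Fin.suc j)) (R.zeroˡ (det (minor I (Fin.suc j))))) ⟩
  1ℝ * 1ℝ + 0ℝ
    ≈⟨ solve 0 (con 1ℚ :* con 1ℚ :+ con 0ℚ := con 1ℚ) ≈-refl ⟩
  1ℝ ∎
  where
  I : Matrix (suc m)
  I = diagonal λ _ → 1ℝ

det-zeroRow₀ : (X : Matrix (suc m)) → (∀ j → X Fin.zero j ≈ 0ℝ) → det X ≈ 0ℝ
det-zeroRow₀ X x≈0 = ∑-zero λ j → alternate-0 (toℕ j)
  (R.trans (*-cong (x≈0 j) (≈-refl {det (minor X j)})) (R.zeroˡ (det (minor X j))))

det-zeroRow₁ : (X : Matrix (suc (suc m))) → (∀ j → X (Fin.suc Fin.zero) j ≈ 0ℝ) → det X ≈ 0ℝ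
det-zeroRow₁ X x≈0 = ∑-zero λ j → alternate-0 (toℕ j)
  (R.trans (*-cong (≈-refl {X Fin.zero j}) (det-zeroRow₀ (minor X j) λ k → x≈0 (punchIn j k)))
           (R.zeroʳ (X Fin.zero j)))

-- Limits

record Bounded (S : ℕ → ℝ) : Set where
  constructor mkBounded
  field
    bound : ℝ
    upper : ∀ k → NonNeg (bound - S k)
    lower : ∀ k → NonNeg (bound + S k)

-- `x * x + 1` bounds both `x` and `- x` without an absolute value: the two gaps are (x ∓ ½)² + ¾.
bounded-const : ∀ x → Bounded λ _ → x
bounded-const x = mkBounded (x * x + 1ℝ)
  (λ _ → NonNeg-cong
    (solve 1 (λ x → (x :- con ½) :* (x :- con ½) :+ (con ½ :+ con (½ ℚ.* ½)) := x :* x :+ con 1ℚ :- x) ≈-refl x)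
    (NonNeg-+ (NonNeg-square (x - fromℚ ½)) ¾≥0))
  (λ _ → NonNeg-cong
    (solve 1 (λ x → (x :+ con ½) :* (x :+ con ½) :+ (con ½ :+ con (½ ℚ.* ½)) := x :* x :+ con 1ℚ :+ x) ≈-refl x)
    (NonNeg-+ (NonNeg-square (x + fromℚ ½)) ¾≥0))
  where
  ½>0 : Pos (fromℚ ½)
  ½>0 = Pos-fromℚ (ℚ.positive⁻¹ ½)
  ¾≥0 : NonNeg (fromℚ ½ + fromℚ (½ ℚ.* ½))
  ¾≥0 = Pos⇒NonNeg (Pos-+ ½>0 (Pos-fromℚ (ℚ.positive⁻¹ (½ ℚ.* ½))))

bounded-step : Bounded step
bounded-step = mkBounded (fromℕ 2) step≤2
  (λ k → NonNeg-+ (Pos⇒NonNeg (Pos-fromℚ (ℚ.positive⁻¹ (+ 2 ℚ./ 1)))) (Pos⇒NonNeg (Pos-step k)))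

bounded-+ : ∀ {S T} → Bounded S → Bounded T → Bounded λ k → S k + T k
bounded-+ {S} {T} (mkBounded L L-S L+S) (mkBounded M M-T M+T) = mkBounded (L + M)
  (λ k → NonNeg-cong (solve 4 (λ l m s t → (l :- s) :+ (m :- t) := l :+ m :- (s :+ t)) ≈-refl L M (S k) (T k))
    (NonNeg-+ (L-S k) (M-T k)))
  (λ k → NonNeg-cong (solve 4 (λ l m s t → (l :+ s) :+ (m :+ t) := l :+ m :+ (s :+ t)) ≈-refl L M (S k) (T k))
    (NonNeg-+ (L+S k) (M+T k)))

-- Each gap is a nonnegative combination of gaps of the factors, as in 2(lm - st) = (l - s)(m + t) +
-- (l + s)(m - t).
bounded-* : ∀ {S T} → Bounded S → Bounded T → Bounded λ k → S k * T k
bounded-* {S} {T} (mkBounded L L-S L+S) (mkBounded M M-T M+T) = mkBounded (L * M)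
  (λ k → NonNeg-cong (solve 4 (λ l m s t →
      con ½ :* ((l :- s) :* (m :+ t) :+ (l :+ s) :* (m :- t)) := l :* m :- s :* t) ≈-refl L M (S k) (T k))
    (NonNeg-* ½≥0 (NonNeg-+ (NonNeg-* (L-S k) (M+T k)) (NonNeg-* (L+S k) (M-T k)))))
  (λ k → NonNeg-cong (solve 4 (λ l m s t →
      con ½ :* ((l :- s) :* (m :- t) :+ (l :+ s) :* (m :+ t)) := l :* m :+ s :* t) ≈-refl L M (S k) (T k))
    (NonNeg-* ½≥0 (NonNeg-+ (NonNeg-* (L-S k) (M-T k)) (NonNeg-* (L+S k) (M+T k)))))
  where
  ½≥0 : NonNeg (fromℚ ½)
  ½≥0 = Pos⇒NonNeg (Pos-fromℚ (ℚ.positive⁻¹ ½))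

-- Convergence at the rate O(1/(k+1)): unlike the ε-N form, it is closed under
-- ring operations by algebra alone.
record Lim (P : ℕ → ℝ) (x : ℝ) : Set where
  constructor mkLim
  field
    slope   : ℕ → ℝ
    bounded : Bounded slope
    linear  : ∀ k → P k ≈ x + step k * slope k

lim-cong : ∀ {P P′ x x′} → (∀ k → P k ≈ P′ k) → x ≈ x′ → Lim P x → Lim P′ x′
lim-cong P≈P′ x≈x′ (mkLim S S-bounded eq) =
  mkLim S S-bounded λ k → R.trans (R.sym (P≈P′ k)) (R.trans (eq k) (+-cong x≈x′ ≈-refl))

lim-const : ∀ x → Lim (λ _ → x) x
lim-const x = mkLim (λ _ → 0ℝ) (bounded-const 0ℝ) λ k →
  solve 2 (λ x s → x := x :+ s :* con 0ℚ) ≈-refl x (step k)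

lim-step : Lim step 0ℝ
lim-step = mkLim (λ _ → 1ℝ) (bounded-const 1ℝ) λ k →
  solve 1 (λ s → s := con 0ℚ :+ s :* con 1ℚ) ≈-refl (step k)

lim-+ : ∀ {P Q x y} → Lim P x → Lim Q y → Lim (λ k → P k + Q k) (x + y)
lim-+ {P} {Q} {x} {y} (mkLim S S-bounded P≈) (mkLim T T-bounded Q≈) =
  mkLim (λ k → S k + T k) (bounded-+ S-bounded T-bounded) λ k →
    R.trans (+-cong (P≈ k) (Q≈ k))
      (solve 5 (λ x y u s t → (x :+ u :* s) :+ (y :+ u :* t) := x :+ y :+ u :* (s :+ t)) ≈-refl
        x y (step k) (S k) (T k))

lim-* : ∀ {P Q x y} → Lim P x → Lim Q y → Lim (λ k → P k * Q k) (x * y)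
lim-* {P} {Q} {x} {y} (mkLim S S-bounded P≈) (mkLim T T-bounded Q≈) =
  mkLim (λ k → x * T k + (y * S k + step k * (S k * T k)))
    (bounded-+ (bounded-* (bounded-const x) T-bounded)
      (bounded-+ (bounded-* (bounded-const y) S-bounded)
                 (bounded-* bounded-step (bounded-* S-bounded T-bounded))))
    λ k → R.trans (*-cong (P≈ k) (Q≈ k))
      (solve 5 (λ x y u s t → (x :+ u :* s) :* (y :+ u :* t) :=
                              x :* y :+ u :* (x :* t :+ (y :* s :+ u :* (s :* t)))) ≈-refl
        x y (step k) (S k) (T k))

lim-neg : ∀ {P x} → Lim P x → Lim (λ k → - P k) (- x)
lim-neg {P} {x} l = lim-cong
  (λ k → solve 1 (λ x → con (ℚ.- 1ℚ) :* x := :- x) ≈-refl (P k))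
  (solve 1 (λ x → con (ℚ.- 1ℚ) :* x := :- x) ≈-refl x)
  (lim-* (lim-const (fromℚ (ℚ.- 1ℚ))) l)

lim-sub : ∀ {P Q x y} → Lim P x → Lim Q y → Lim (λ k → P k - Q k) (x - y)
lim-sub p q = lim-+ p (lim-neg q)

-- If x < 0, some `k` makes - x exceed the largest possible error `step k * L`, and then `P k` is
-- negative.
lim-NonNeg : ∀ {P x} → Lim P x → (∀ k → NonNeg (P k)) → NonNeg x
lim-NonNeg {P} {x} (mkLim S (mkBounded L L-S _) P≈) P≥0 = mkNonNeg λ -x>0 →
  let (k , gap) = step-small -x>0 L
  in Pos-+-NonNeg gap (NonNeg-* (Pos⇒NonNeg (Pos-step k)) (L-S k)) λ p →
       ¬neg (P≥0 k) (Pos-cong (R.trans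
         (solve 4 (λ x u l s → (:- x :- u :* l) :+ u :* (l :- s) := :- (x :+ u :* s)) ≈-refl
           x (step k) L (S k))
         (neg-cong (R.sym (P≈ k)))) p)

NonNeg-antisym : ∀ {x y} → NonNeg (x - y) → NonNeg (y - x) → x ≈ y
NonNeg-antisym {x} {y} p q = R.trans (solve 2 (λ x y → x := (x :- y) :+ y) ≈-refl x y)
  (R.trans (+-cong (¬Pos∧¬Neg⇒≈0
      (λ pos → ¬neg q (Pos-cong (solve 2 (λ x y → x :- y := :- (y :- x)) ≈-refl x y) pos))
      (¬neg p)) (≈-refl {y})) (R.+-identityˡ y))

lim-unique : ∀ {P x y} → Lim P x → Lim P y → x ≈ y
lim-unique {P} p q = NonNeg-antisym (differ p q) (differ q p)
  where
  differ : ∀ {x y} → Lim P x → Lim P y → NonNeg (x - y)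
  differ p q = lim-NonNeg (lim-sub p q) λ k → NonNeg-0 (R.-‿inverseʳ (P k))

lim-∑ : {P : ℕ → Vector ℝ m} {x : Vector ℝ m} → (∀ i → Lim (λ k → P k i) (x i)) →
        Lim (λ k → ∑ (P k)) (∑ x)
lim-∑ {zero}  l = lim-const 0ℝ
lim-∑ {suc m} l = lim-+ (l Fin.zero) (lim-∑ λ i → l (Fin.suc i))

lim-∏ : {P : ℕ → Vector ℝ m} {x : Vector ℝ m} → (∀ i → Lim (λ k → P k i) (x i)) →
        Lim (λ k → ∏ (P k)) (∏ x)
lim-∏ {zero}  l = lim-const 1ℝ
lim-∏ {suc m} l = lim-* (l Fin.zero) (lim-∏ λ i → l (Fin.suc i))

lim-alternate : ∀ j {P x} → Lim P x → Lim (λ k → alternate j (P k)) (alternate j x)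
lim-alternate zero    l = l
lim-alternate (suc j) l = lim-neg (lim-alternate j l)

lim-det : {P : ℕ → Matrix m} {X : Matrix m} → (∀ i j → Lim (λ k → P k i j) (X i j)) →
          Lim (λ k → det (P k)) (det X)
lim-det {zero}  l = lim-const 1ℝ
lim-det {suc m} l = lim-∑ λ j → lim-alternate (toℕ j)
  (lim-* (l Fin.zero j) (lim-det λ i k → l (Fin.suc i) (punchIn j k)))

-- Products of linear factors

poly : Vector ℝ m → ℝ → ℝ
poly v t = ∏ λ i → t - v i

derivative : Vector ℝ m → ℝ → ℝ
derivative {zero}  v t = 0ℝ
derivative {suc m} v t = poly (tail v) t + (t - head v) * derivative (tail v) t

-- The difference quotient of `poly v` with the division by `u` carried out factor by factor, so
-- that it makes sense at `u = 0`, where it is the derivative.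
quotient : Vector ℝ m → ℝ → ℝ → ℝ
quotient {zero}  v t u = 0ℝ
quotient {suc m} v t u = poly (tail v) (t + u) + (t - head v) * quotient (tail v) t u

poly-quotient : (v : Vector ℝ m) → ∀ t u → poly v (t + u) ≈ poly v t + u * quotient v t u
poly-quotient {zero}  v t u = solve 1 (λ u → con 1ℚ := con 1ℚ :+ u :* con 0ℚ) ≈-refl u
poly-quotient {suc m} v t u = begin
  (t + u - head v) * P
    ≈⟨ solve 4 (λ t u h p → (t :+ u :- h) :* p := (t :- h) :* p :+ u :* p) ≈-refl t u (head v) P ⟩
  (t - head v) * P + u * P
    ≈⟨ +-cong (*-cong (≈-refl {t - head v}) (poly-quotient (tail v) t u)) ≈-refl ⟩
  (t - head v) * (poly (tail v) t + u * quotient (tail v) t u) + u * P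
    ≈⟨ solve 5 (λ a p u q p′ → a :* (p :+ u :* q) :+ u :* p′ := a :* p :+ u :* (p′ :+ a :* q)) ≈-refl
         (t - head v) (poly (tail v) t) u (quotient (tail v) t u) P ⟩
  poly v t + u * quotient v t u ∎
  where
  P : ℝ
  P = poly (tail v) (t + u)

lim-poly : (v : Vector ℝ m) → ∀ {P t} → Lim P t → Lim (λ k → poly v (P k)) (poly v t)
lim-poly v l = lim-∏ λ i → lim-sub l (lim-const (v i))

lim-derivative : (v : Vector ℝ m) → ∀ {P t} → Lim P t → Lim (λ k → derivative v (P k)) (derivative v t)
lim-derivative {zero}  v l = lim-const 0ℝ
lim-derivative {suc m} v l = lim-+ (lim-poly (tail v) l)
  (lim-* (lim-sub l (lim-const (head v))) (lim-derivative (tail v) l))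

lim-shift : ∀ t → Lim (λ k → t + step k) t
lim-shift t = lim-cong (λ _ → ≈-refl) (R.+-identityʳ t) (lim-+ (lim-const t) lim-step)

lim-quotient : (v : Vector ℝ m) → ∀ t → Lim (λ k → quotient v t (step k)) (derivative v t)
lim-quotient {zero}  v t = lim-const 0ℝ
lim-quotient {suc m} v t = lim-+ (lim-poly (tail v) (lim-shift t))
  (lim-* (lim-const (t - head v)) (lim-quotient (tail v) t))

poly-remove : (v : Vector ℝ (suc m)) → ∀ i t → poly v t ≈ (t - v i) * poly (removeAt v i) t
poly-remove v i t = ∏.sum-remove {i = i} λ j → t - v j

derivative-remove : (v : Vector ℝ (suc m)) → ∀ i t →
  derivative v t ≈ poly (removeAt v i) t + (t - v i) * derivative (removeAt v i) t
derivative-remove {m} v Fin.zero t = ≈-refl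
derivative-remove {suc m} v (Fin.suc i) t = begin
  poly (tail v) t + (t - head v) * derivative (tail v) t
    ≈⟨ +-cong (poly-remove (tail v) i t) (*-cong (≈-refl {t - head v}) (derivative-remove (tail v) i t)) ⟩
  (t - v (Fin.suc i)) * p + (t - head v) * (p + (t - v (Fin.suc i)) * q)
    ≈⟨ solve 4 (λ x y p q → x :* p :+ y :* (p :+ x :* q) := y :* p :+ x :* (p :+ y :* q)) ≈-refl
         (t - v (Fin.suc i)) (t - head v) p q ⟩
  (t - head v) * p + (t - v (Fin.suc i)) * (p + (t - head v) * q) ∎
  where
  p q : ℝ
  p = poly (removeAt (tail v) i) t
  q = derivative (removeAt (tail v) i) t

-- Nonnegativity of `excess` expresses f g′ - f′ g ≥ (f - g)².
wronskian excess : Vector ℝ m → Vector ℝ m → ℝ → ℝ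
wronskian v w t = poly v t * derivative w t - derivative v t * poly w t
excess v w t = wronskian v w t - (poly v t - poly w t) * (poly v t - poly w t)

lim-excess : (v w : Vector ℝ m) → ∀ {P t} → Lim P t → Lim (λ k → excess v w (P k)) (excess v w t)
lim-excess v w l = lim-sub
  (lim-sub (lim-* (lim-poly v l) (lim-derivative w l)) (lim-* (lim-derivative v l) (lim-poly w l)))
  (lim-* (lim-sub (lim-poly v l) (lim-poly w l)) (lim-sub (lim-poly v l) (lim-poly w l)))

-- With f = zF and g = zG the derivative of z contributes F·zG to both products of the Wronskian and
-- cancels; what remains is homogeneous of degree two in z.
excess-remove : (v w : Vector ℝ (suc m)) → ∀ i j → v i ≈ w j → ∀ t →
  excess v w t ≈ ((t - v i) * (t - v i)) * excess (removeAt v i) (removeAt w j) t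
excess-remove v w i j vᵢ≈wⱼ t = begin
  excess v w t
    ≈⟨ +-cong (+-cong (*-cong f≈ g′≈) (neg-cong (*-cong f′≈ g≈)))
              (neg-cong (*-cong (+-cong f≈ (neg-cong g≈)) (+-cong f≈ (neg-cong g≈)))) ⟩
  (z * F * (G + z * G′) - (F + z * F′) * (z * G)) - (z * F - z * G) * (z * F - z * G)
    ≈⟨ solve 5 (λ z F G F′ G′ →
         (z :* F :* (G :+ z :* G′) :- (F :+ z :* F′) :* (z :* G)) :- (z :* F :- z :* G) :* (z :* F :- z :* G) :=
         (z :* z) :* ((F :* G′ :- F′ :* G) :- (F :- G) :* (F :- G))) ≈-refl z F G F′ G′ ⟩
  (z * z) * excess (removeAt v i) (removeAt w j) t ∎
  where
  z F G F′ G′ : ℝ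
  z = t - v i
  F = poly (removeAt v i) t
  G = poly (removeAt w j) t
  F′ = derivative (removeAt v i) t
  G′ = derivative (removeAt w j) t

  z≈ : t - w j ≈ z
  z≈ = +-cong ≈-refl (neg-cong (≈-sym vᵢ≈wⱼ))
  f≈ : poly v t ≈ z * F
  f≈ = poly-remove v i t
  g≈ : poly w t ≈ z * G
  g≈ = R.trans (poly-remove w j t) (*-cong z≈ (≈-refl {G}))
  f′≈ : derivative v t ≈ F + z * F′
  f′≈ = derivative-remove v i t
  g′≈ : derivative w t ≈ G + z * G′
  g′≈ = R.trans (derivative-remove w j t) (+-cong (≈-refl {G}) (*-cong z≈ (≈-refl {G′})))

-- Away from the common root the positive square can be divided out. At the root itself the
-- inequality is recovered as a limit along `c + step n`, by continuity of `excess`.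
excess-cancel : (v w : Vector ℝ (suc m)) → ∀ i j → v i ≈ w j →
  (∀ t → NonNeg (excess v w t)) → ∀ t → NonNeg (excess (removeAt v i) (removeAt w j) t)
excess-cancel v w i j vᵢ≈wⱼ excess≥0 t = NonNeg-stable λ k → trichotomy (t - c) λ where
    (inj₁ p)        → k (away (Pos-* p p))
    (inj₂ (inj₁ z)) → k (lim-NonNeg (lim-excess v′ w′ (near z))
                          λ n → away {c + step n} (Pos-cong
                            (solve 2 (λ c s → s :* s := (c :+ s :- c) :* (c :+ s :- c)) ≈-refl c (step n))
                            (Pos-* (Pos-step n) (Pos-step n))))
    (inj₂ (inj₂ n)) → k (away (Pos-cong
                          (solve 1 (λ x → (:- x) :* (:- x) := x :* x) ≈-refl (t - c)) (Pos-* n n)))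
  where
  c : ℝ
  c = v i
  v′ w′ : Vector ℝ _
  v′ = removeAt v i
  w′ = removeAt w j

  away : ∀ {t} → Pos ((t - c) * (t - c)) → NonNeg (excess v′ w′ t)
  away {t} p = NonNeg-cancel p (NonNeg-cong (excess-remove v w i j vᵢ≈wⱼ t) (excess≥0 t))

  near : t - c ≈ 0ℝ → Lim (λ n → c + step n) t
  near z = lim-cong (λ _ → ≈-refl)
    (R.trans (R.trans (R.sym (R.+-identityʳ c)) (+-cong (≈-refl {c}) (≈-sym z)))
      (solve 2 (λ c t → c :+ (t :- c) := t) ≈-refl c t))
    (lim-shift c)

-- Comparison of roots

∏≈0⇒ : {x : Vector ℝ m} → ∏ x ≈ 0ℝ → ¬ ¬ (∃[ i ] x i ≈ 0ℝ)
∏≈0⇒ {zero}  1≈0 k = ¬Pos0 1≈0 (Pos-fromℚ 0<1)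
∏≈0⇒ {suc m} x≈0 k = x*y≈0⇒ x≈0 λ where
  (inj₁ x₀≈0) → k (Fin.zero , x₀≈0)
  (inj₂ ∏≈0)  → ∏≈0⇒ ∏≈0 λ (i , xᵢ≈0) → k (Fin.suc i , xᵢ≈0)

∑-NonNeg : {x : Vector ℝ m} → (∀ i → NonNeg (x i)) → NonNeg (∑ x)
∑-NonNeg {zero}  x≥0 = NonNeg-0 ≈-refl
∑-NonNeg {suc n} x≥0 = NonNeg-+ (x≥0 Fin.zero) (∑-NonNeg λ i → x≥0 (Fin.suc i))

∏-pairs-NonNeg : (x y : Vector ℝ m) → (∀ i → NonNeg (x i * y i)) → NonNeg (∏ x * ∏ y)
∏-pairs-NonNeg {zero}  x y xy≥0 = NonNeg-square 1ℝ
∏-pairs-NonNeg {suc m} x y xy≥0 = NonNeg-cong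
  (solve 4 (λ a b c d → (a :* b) :* (c :* d) := (a :* c) :* (b :* d)) ≈-refl
    (head x) (head y) (∏ (tail x)) (∏ (tail y)))
  (NonNeg-* (xy≥0 Fin.zero) (∏-pairs-NonNeg (tail x) (tail y) λ i → xy≥0 (Fin.suc i)))

Decreasing : Vector ℝ m → Set
Decreasing v = ∀ {i j} → i Fin.≤ j → NonNeg (v i - v j)

NonNeg-chain : ∀ {x y z} → NonNeg (x - y) → NonNeg (y - z) → NonNeg (x - z)
NonNeg-chain {x} {y} {z} p q = NonNeg-cong
  (solve 3 (λ x y z → (x :- y) :+ (y :- z) := x :- z) ≈-refl x y z) (NonNeg-+ p q)

punchIn-≥ : (i : Fin (suc m)) (l : Fin m) → toℕ l ℕ.≤ toℕ (punchIn i l)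
punchIn-≥ Fin.zero    l           = ℕ.n≤1+n (toℕ l)
punchIn-≥ (Fin.suc i) Fin.zero    = ℕ.z≤n
punchIn-≥ (Fin.suc i) (Fin.suc l) = ℕ.s≤s (punchIn-≥ i l)

punchIn-≤ : (i : Fin (suc m)) (l : Fin m) → toℕ (punchIn i l) ℕ.≤ suc (toℕ l)
punchIn-≤ Fin.zero    l           = ℕ.≤-refl
punchIn-≤ (Fin.suc i) Fin.zero    = ℕ.z≤n
punchIn-≤ (Fin.suc i) (Fin.suc l) = ℕ.s≤s (punchIn-≤ i l)

punchIn-below : (i : Fin (suc m)) (l : Fin m) → toℕ l ℕ.< toℕ i → toℕ (punchIn i l) ℕ.≤ toℕ l
punchIn-below (Fin.suc i) Fin.zero    _             = ℕ.z≤n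
punchIn-below (Fin.suc i) (Fin.suc l) (ℕ.s≤s l<i) = ℕ.s≤s (punchIn-below i l l<i)

punchIn-above : (i : Fin (suc m)) (l : Fin m) → toℕ i ℕ.≤ toℕ l → suc (toℕ l) ℕ.≤ toℕ (punchIn i l)
punchIn-above Fin.zero    l           _             = ℕ.≤-refl
punchIn-above (Fin.suc i) (Fin.suc l) (ℕ.s≤s i≤l) = ℕ.s≤s (punchIn-above i l i≤l)

-- Before position `i`, entry `k` is compared through entry `k` of the shortened lists; past both
-- positions, through entry `k - 1`. Monotonicity absorbs the possible shift by one.
insert-dominated : (v w : Vector ℝ (suc m)) → Decreasing v → Decreasing w → ∀ i j → v i ≈ w j →
  (∀ l → NonNeg (removeAt w j l - removeAt v i l)) → ∀ k → NonNeg (w k - v k)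
insert-dominated {m} v w v↓ w↓ i j vᵢ≈wⱼ h k with toℕ k ℕ.<? toℕ i
... | yes k<i = NonNeg-chain (w↓ k≤) (NonNeg-chain (h l) (v↓ ≤k))
  where
  k<m : toℕ k ℕ.< m
  k<m = ℕ.<-≤-trans k<i (ℕ.s≤s⁻¹ (Fin.toℕ<n i))
  l : Fin m
  l = fromℕ< k<m
  l≡k : toℕ l ≡ toℕ k
  l≡k = Fin.toℕ-fromℕ< k<m
  k≤ : k Fin.≤ punchIn j l
  k≤ = ℕ.≤-trans (ℕ.≤-reflexive (≡.sym l≡k)) (punchIn-≥ j l)
  ≤k : punchIn i l Fin.≤ k
  ≤k = ℕ.≤-trans (punchIn-below i l (≡.subst (ℕ._< toℕ i) (≡.sym l≡k) k<i)) (ℕ.≤-reflexive l≡k)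
... | no k≮i with k | toℕ k ℕ.≤? toℕ j
-- From `i` up to `j` the common value separates the lists: `w k ≥ w j = v i ≥ v k`.
...   | k         | yes k≤j = NonNeg-chain (w↓ k≤j)
          (NonNeg-cong (+-cong vᵢ≈wⱼ (≈-refl { - v k})) (v↓ (ℕ.≮⇒≥ k≮i)))
...   | Fin.zero  | no k≰j  = contradiction ℕ.z≤n k≰j
...   | Fin.suc l | no k≰j  = NonNeg-chain (w↓ (punchIn-above j l (ℕ.s≤s⁻¹ (ℕ.≰⇒> k≰j))))
          (NonNeg-chain (h l) (v↓ (punchIn-≤ i l)))

-- At t = v i the excess is −F g − g², where g = poly w t and F omits the
-- vanishing factor of poly v t. If w i < v i then F g pairs off into
-- nonnegative products, so that g = 0.
dominated-step : (v w : Vector ℝ (suc m)) → Decreasing v → Decreasing w →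
  (∀ t → NonNeg (excess v w t)) → ¬ (∃[ i ] ∃[ j ] v i ≈ w j) →
  ∀ i → (∀ k → k Fin.< i → NonNeg (w k - v k)) → NonNeg (w i - v i)
dominated-step v w v↓ w↓ excess≥0 distinct i below = mkNonNeg λ wᵢ<vᵢ →
  let vᵢ≥wᵢ = NonNeg-cong (solve 2 (λ v w → :- (w :- v) := v :- w) ≈-refl (v i) (w i)) (Pos⇒NonNeg wᵢ<vᵢ)
  -- A vanishing g is a product with a zero factor, hence a root shared by both lists, contrary to
  -- `distinct`.
  in ∏≈0⇒ (square≈0 (g²≯0 vᵢ≥wᵢ)) λ (j , t≈wⱼ) → distinct (i , j ,
       R.trans (solve 2 (λ x y → x := (x :- y) :+ y) ≈-refl (v i) (w j))
         (R.trans (+-cong t≈wⱼ (≈-refl {w j})) (R.+-identityˡ (w j))))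
  where
  t g g′ F G : ℝ
  t = v i
  g = poly w t
  g′ = derivative w t
  F = poly (removeAt v i) t
  G = poly (removeAt w i) t

  excess≈ : excess v w t ≈ - (F * g) - g * g
  excess≈ = begin
    excess v w t
      ≈⟨ +-cong (+-cong (*-cong (poly-remove v i t) (≈-refl {g′}))
                        (neg-cong (*-cong (derivative-remove v i t) (≈-refl {g}))))
                (neg-cong (*-cong (+-cong (poly-remove v i t) (≈-refl { - g})) (+-cong (poly-remove v i t) (≈-refl { - g})))) ⟩
    ((t - t) * F * g′ - (F + (t - t) * derivative (removeAt v i) t) * g) - ((t - t) * F - g) * ((t - t) * F - g)
      ≈⟨ solve 5 (λ t F g g′ F′ →
           ((t :- t) :* F :* g′ :- (F :+ (t :- t) :* F′) :* g) :- ((t :- t) :* F :- g) :* ((t :- t) :* F :- g) :=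
           :- (F :* g) :- g :* g) ≈-refl t F g g′ (derivative (removeAt v i) t) ⟩
    - (F * g) - g * g ∎

  module _ (vᵢ≥wᵢ : NonNeg (v i - w i)) where
    -- Before `i` both factors are at most 0, since `w k ≥ v k ≥ t`; after `i` both are at least 0,
    -- since `t ≥ v k` and `t ≥ w i ≥ w k`.
    pair : ∀ l → NonNeg ((t - removeAt v i l) * (t - removeAt w i l))
    pair l with toℕ (punchIn i l) ℕ.<? toℕ i
    ... | yes k<i = NonNeg-cong
            (solve 3 (λ t x y → (x :- t) :* (y :- t) := (t :- x) :* (t :- y)) ≈-refl t (v (punchIn i l)) (w (punchIn i l)))
            (NonNeg-* (v↓ (ℕ.<⇒≤ k<i)) (NonNeg-chain (below (punchIn i l) k<i) (v↓ (ℕ.<⇒≤ k<i))))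
    ... | no k≮i = NonNeg-* (v↓ (ℕ.≮⇒≥ k≮i)) (NonNeg-chain vᵢ≥wᵢ (w↓ (ℕ.≮⇒≥ k≮i)))

    Fg≥0 : NonNeg (F * g)
    Fg≥0 = NonNeg-cong
      (R.trans (solve 3 (λ z F G → z :* (F :* G) := F :* (z :* G)) ≈-refl (t - w i) F G)
               (*-cong (≈-refl {F}) (R.sym (poly-remove w i t))))
      (NonNeg-* vᵢ≥wᵢ (∏-pairs-NonNeg (λ l → t - removeAt v i l) (λ l → t - removeAt w i l) pair))

    g²≯0 : ¬ Pos (g * g)
    g²≯0 p = ¬neg
      (NonNeg-cong (solve 2 (λ a b → (:- a :- b) :+ a := :- b) ≈-refl (F * g) (g * g))
        (NonNeg-+ (NonNeg-cong excess≈ (excess≥0 t)) Fg≥0))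
      (Pos-cong (solve 1 (λ b → b := :- (:- b)) ≈-refl (g * g)) p)

-- The goal is stable, so it may be assumed false. A common root would then be absurd, since
-- cancelling it and recursing on shorter lists proves the goal; this leaves the case without common
-- roots.
dominated : (v w : Vector ℝ m) → Decreasing v → Decreasing w →
  (∀ t → NonNeg (excess v w t)) → ∀ i → NonNeg (w i - v i)
dominated {suc m} v w v↓ w↓ excess≥0 k = NonNeg-stable λ ¬goal →
  let distinct : ¬ (∃[ i ] ∃[ j ] v i ≈ w j)
      distinct = λ (i , j , vᵢ≈wⱼ) → ¬goal (insert-dominated v w v↓ w↓ i j vᵢ≈wⱼ
        (dominated (removeAt v i) (removeAt w j)
          (λ p → v↓ (Fin.punchIn-mono-≤ i _ _ p)) (λ p → w↓ (Fin.punchIn-mono-≤ j _ _ p))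
          (excess-cancel v w i j vᵢ≈wⱼ excess≥0)) k)
  in ¬goal (by-distinct distinct (suc (toℕ k)) k ℕ.≤-refl)
  where
  -- `n` is fuel for strong induction on the position of `i`.
  by-distinct : ¬ (∃[ i ] ∃[ j ] v i ≈ w j) → ∀ n i → toℕ i ℕ.< n → NonNeg (w i - v i)
  by-distinct distinct (suc n) i i<1+n = dominated-step v w v↓ w↓ excess≥0 distinct i λ k k<i →
    by-distinct distinct n k (ℕ.<-≤-trans k<i (ℕ.s≤s⁻¹ i<1+n))

-- Rank-one perturbation

step-inverse : ∀ k → step k * fromℕ (suc k) ≈ 1ℝ
step-inverse k = ≡⇒≈ λ _ → ℚ.toℚᵘ-injective
  (ℚᵘ.≃-trans (ℚ.toℚᵘ-homo-* (+ 1 ℚ./ suc k) (+ suc k ℚ./ 1))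
  (ℚᵘ.≃-trans (ℚᵘ.*-cong (ℚ.toℚᵘ-fromℚᵘ (ℚᵘ.mkℚᵘ (+ 1) k)) (ℚ.toℚᵘ-fromℚᵘ (ℚᵘ.mkℚᵘ (+ suc k) 0)))
             (ℚᵘ.*≡* (cong +_ (ℕ.*-assoc 1 (suc k) 1)))))

step-cancel : ∀ k {x y} → step k * x ≈ step k * y → x ≈ y
step-cancel k {x} {y} eq = begin
  x                              ≈⟨ expand x ⟩
  fromℕ (suc k) * (step k * x)   ≈⟨ *-cong (≈-refl {fromℕ (suc k)}) eq ⟩
  fromℕ (suc k) * (step k * y)   ≈⟨ expand y ⟨
  y                              ∎
  where
  expand : ∀ x → x ≈ fromℕ (suc k) * (step k * x)
  expand x = R.trans (R.trans (R.sym (R.*-identityˡ x)) (*-cong (≈-sym (step-inverse k)) (≈-refl {x})))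
    (solve 3 (λ s T x → s :* T :* x := T :* (s :* x)) ≈-refl (step k) (fromℕ (suc k)) x)

-- u ^ m * poly v (1 / u), and its difference quotient at u = 0.
reversed : Vector ℝ m → ℝ → ℝ
reversed v u = ∏ λ i → 1ℝ - u * v i

reversedQuotient : Vector ℝ m → ℝ → ℝ
reversedQuotient {zero}  v u = 0ℝ
reversedQuotient {suc m} v u = - head v * reversed (tail v) u + reversedQuotient (tail v) u

reversed-quotient : (v : Vector ℝ m) → ∀ u → reversed v u ≈ 1ℝ + u * reversedQuotient v u
reversed-quotient {zero}  v u = solve 1 (λ u → con 1ℚ := con 1ℚ :+ u :* con 0ℚ) ≈-refl u
reversed-quotient {suc m} v u = begin
  (1ℝ - u * h) * P
    ≈⟨ solve 3 (λ u h p → (con 1ℚ :- u :* h) :* p := p :+ u :* (:- h :* p)) ≈-refl u h P ⟩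
  P + u * (- h * P)
    ≈⟨ +-cong (reversed-quotient (tail v) u) ≈-refl ⟩
  (1ℝ + u * reversedQuotient (tail v) u) + u * (- h * P)
    ≈⟨ solve 3 (λ u q x → (con 1ℚ :+ u :* q) :+ u :* x := con 1ℚ :+ u :* (x :+ q)) ≈-refl
         u (reversedQuotient (tail v) u) (- h * P) ⟩
  1ℝ + u * reversedQuotient v u ∎
  where
  h P : ℝ
  h = head v
  P = reversed (tail v) u

∏-const-1 : ∀ m → ∏-const 1ℝ m ≈ 1ℝ
∏-const-1 zero    = ≈-refl
∏-const-1 (suc m) = R.trans (R.*-identityˡ (∏-const 1ℝ m)) (∏-const-1 m)

-- ∏ (1 - u vᵢ) = 1 - u ∑ v + O(u²); the limit is the second coefficient of `poly v`.
lim-reversedQuotient : (v : Vector ℝ m) → Lim (λ k → reversedQuotient v (step k)) (- ∑ v)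
lim-reversedQuotient {zero}  v = lim-cong (λ _ → ≈-refl) (solve 0 (con 0ℚ := :- con 0ℚ) ≈-refl) (lim-const 0ℝ)
lim-reversedQuotient {suc m} v = lim-cong (λ _ → ≈-refl)
  (R.trans (+-cong (*-cong (≈-refl { - head v}) (∏-const-1 m)) ≈-refl)
    (solve 2 (λ h s → :- h :* con 1ℚ :+ :- s := :- (h :+ s)) ≈-refl (head v) (∑ (tail v))))
  (lim-+ (lim-* (lim-const (- head v)) (lim-∏ λ i → lim-cong (λ _ → ≈-refl)
           (solve 1 (λ x → con 1ℚ :- con 0ℚ :* x := con 1ℚ) ≈-refl (v (Fin.suc i)))
           (lim-sub (lim-const 1ℝ) (lim-* lim-step (lim-const (v (Fin.suc i)))))))
         (lim-reversedQuotient (tail v)))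

reversed-poly : (v : Vector ℝ m) → ∀ k →
  ∏-const (step k) m * poly v (fromℕ (suc k)) ≈ 1ℝ + step k * reversedQuotient v (step k)
reversed-poly {m} v k = begin
  ∏-const u m * poly v T
    ≈⟨ ∏.∑-distrib-+ (λ _ → u) (λ i → T - v i) ⟨
  (∏ λ i → u * (T - v i))
    ≈⟨ ∏.sum-cong-≋ (λ i → R.trans (solve 3 (λ u t v → u :* (t :- v) := u :* t :- u :* v) ≈-refl u T (v i))
                             (+-cong (step-inverse k) ≈-refl)) ⟩
  reversed v u
    ≈⟨ reversed-quotient v u ⟩
  1ℝ + u * reversedQuotient v u ∎
  where
  u T : ℝ
  u = step k
  T = fromℕ (suc k)

module RankOne (X : Matrix (suc m)) (X-sym : Symmetric X) (v w : Vector ℝ (suc m))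
  (v-splits : ∀ t → charPoly X t ≈ poly v t)
  (w-splits : ∀ t → charPoly (X -ᴹ diagonal (firstEntry (- 1ℝ))) t ≈ poly w t) where

  cof : ℝ → Vector ℝ (suc m)
  cof t = cofactors (charMatrix X t)

  poly-difference : ∀ t → cof t Fin.zero ≈ poly v t - poly w t
  poly-difference t = begin
    cof t Fin.zero
      ≈⟨ solve 2 (λ p q → q := p :- (p :- q)) ≈-refl (charPoly X t) (cof t Fin.zero) ⟩
    charPoly X t - (charPoly X t - cof t Fin.zero)
      ≈⟨ +-cong (v-splits t) (neg-cong (R.trans (R.sym (charPoly-perturb X t)) (w-splits t))) ⟩
    poly v t - poly w t ∎

  -- This is `charPoly-cofactors` at s and s + u, divided by u. Its left side tends to the Wronskian
  -- as u tends to 0.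
  quotients-cofactors : ∀ s k →
    poly v s * quotient w s (step k) - quotient v s (step k) * poly w s ≈ cof (s + step k) · cof s
  quotients-cofactors s k = step-cancel k (begin
    u * (p * w′ - v′ * g)
      ≈⟨ solve 5 (λ u p g v′ w′ → u :* (p :* w′ :- v′ :* g) :=
           (p :- g) :* (p :+ u :* v′) :- ((p :+ u :* v′) :- (g :+ u :* w′)) :* p) ≈-refl u p g v′ w′ ⟩
    (p - g) * (p + u * v′) - ((p + u * v′) - (g + u * w′)) * p
      ≈⟨ +-cong (*-cong (≈-refl {p - g}) pₜ)
           (neg-cong (*-cong (+-cong pₜ (neg-cong gₜ)) (≈-refl {p}))) ⟩
    (p - g) * poly v t - (poly v t - poly w t) * p
      ≈⟨ +-cong (*-cong (≈-sym (poly-difference s)) (≈-sym (v-splits t)))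
           (neg-cong (*-cong (≈-sym (poly-difference t)) (≈-sym (v-splits s)))) ⟩
    cof s Fin.zero * charPoly X t - cof t Fin.zero * charPoly X s
      ≈⟨ charPoly-cofactors X X-sym s t ⟩
    (t - s) * (cof t · cof s)
      ≈⟨ solve 3 (λ s u d → (s :+ u :- s) :* d := u :* d) ≈-refl s u (cof t · cof s) ⟩
    u * (cof t · cof s) ∎)
    where
    u t p g v′ w′ : ℝ
    u = step k
    t = s + u
    p = poly v s
    g = poly w s
    v′ = quotient v s u
    w′ = quotient w s u
    pₜ : p + u * v′ ≈ poly v t
    pₜ = R.sym (poly-quotient v s u)
    gₜ : g + u * w′ ≈ poly w t
    gₜ = R.sym (poly-quotient w s u)

  lim-cof : ∀ s j → Lim (λ k → cof (s + step k) j) (cof s j)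
  lim-cof s j = lim-alternate (toℕ j) (lim-det λ i k → lim-sub (lim-diagonal (Fin.suc i) (punchIn j k))
                                                            (lim-const (X (Fin.suc i) (punchIn j k))))
    where
    lim-diagonal : ∀ i j → Lim (λ k → diagonal (λ _ → s + step k) i j) (diagonal (λ _ → s) i j)
    lim-diagonal i j with i Fin.≟ j
    ... | yes _ = lim-shift s
    ... | no  _ = lim-const 0ℝ

  wronskian-cofactors : ∀ s → wronskian v w s ≈ cof s · cof s
  wronskian-cofactors s = lim-unique
    (lim-sub (lim-* (lim-const (poly v s)) (lim-quotient w s)) (lim-* (lim-quotient v s) (lim-const (poly w s))))
    (lim-cong (λ k → R.sym (quotients-cofactors s k)) ≈-refl
      (lim-∑ λ j → lim-* (lim-cof s j) (lim-const (cof s j))))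

  -- The Wronskian is the full sum of squared cofactors and f - g is cofactor 0, so the excess is
  -- the sum of the other squares.
  excess-NonNeg : ∀ s → NonNeg (excess v w s)
  excess-NonNeg s = NonNeg-cong (begin
    tail (cof s) · tail (cof s)
      ≈⟨ solve 2 (λ q r → r := (q :* q :+ r) :- q :* q) ≈-refl (cof s Fin.zero) (tail (cof s) · tail (cof s)) ⟩
    (cof s · cof s) - cof s Fin.zero * cof s Fin.zero
      ≈⟨ +-cong (≈-sym (wronskian-cofactors s))
           (neg-cong (*-cong (poly-difference s) (poly-difference s))) ⟩
    excess v w s ∎)
    (∑-NonNeg λ j → NonNeg-square (cof s (Fin.suc j)))

  -- This is `u` times the lower right block of `charMatrix X (1 / u)`, written so that `u = 0` is
  -- allowed and gives the identity.
  scaledMinor : ℝ → Matrix m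
  scaledMinor u i j = diagonal (λ _ → 1ℝ) i j - u * X (Fin.suc i) (Fin.suc j)

  lim-scaledMinor : Lim (λ k → det (scaledMinor (step k))) 1ℝ
  lim-scaledMinor = lim-cong (λ _ → ≈-refl) (det-identity m) (lim-det λ i j →
    lim-cong (λ _ → ≈-refl)
      (solve 2 (λ d x → d :- con 0ℚ :* x := d) ≈-refl (diagonal (λ _ → 1ℝ) i j) (X (Fin.suc i) (Fin.suc j)))
      (lim-sub (lim-const (diagonal (λ _ → 1ℝ) i j)) (lim-* lim-step (lim-const (X (Fin.suc i) (Fin.suc j))))))

  det-scaledMinor : ∀ k → det (scaledMinor (step k)) ≈ ∏-const (step k) m * cof (fromℕ (suc k)) Fin.zero
  det-scaledMinor k = R.trans
    (det-cong λ i j → entry (does (i Fin.≟ j)) (X (Fin.suc i) (Fin.suc j)) (step-inverse k))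
    (det-scale (step k) (minor (charMatrix X (fromℕ (suc k))) Fin.zero))
    where
    entry : ∀ b x {u T} → u * T ≈ 1ℝ →
            (if b then 1ℝ else 0ℝ) - u * x ≈ u * ((if b then T else 0ℝ) - x)
    entry true x {u} {T} uT≈1 = R.trans (+-cong (≈-sym uT≈1) ≈-refl)
      (solve 3 (λ u t x → u :* t :- u :* x := u :* (t :- x)) ≈-refl u T x)
    entry false x {u} {T} uT≈1 = solve 2 (λ u x → con 0ℚ :- u :* x := u :* (con 0ℚ :- x)) ≈-refl u x

  -- The leading 1 of both reversed polynomials cancels. The difference of the polynomials is a
  -- cofactor of size `m`, so scaling by u to the power `suc m` leaves one factor u to divide out.
  reversedQuotient-difference : ∀ k →
    reversedQuotient v (step k) - reversedQuotient w (step k) ≈ det (scaledMinor (step k))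
  reversedQuotient-difference k = step-cancel k (begin
    u * (a′ - b′)
      ≈⟨ solve 3 (λ u a b → u :* (a :- b) := (con 1ℚ :+ u :* a) :- (con 1ℚ :+ u :* b)) ≈-refl u a′ b′ ⟩
    (1ℝ + u * a′) - (1ℝ + u * b′)
      ≈⟨ +-cong (reversed-poly v k) (neg-cong (reversed-poly w k)) ⟨
    (u * U) * poly v T - (u * U) * poly w T
      ≈⟨ solve 4 (λ u U p q → (u :* U) :* p :- (u :* U) :* q := u :* (U :* (p :- q))) ≈-refl u U (poly v T) (poly w T) ⟩
    u * (U * (poly v T - poly w T))
      ≈⟨ *-cong (≈-refl {u}) (R.trans (*-cong (≈-refl {U}) (≈-sym (poly-difference T))) (R.sym (det-scaledMinor k))) ⟩
    u * det (scaledMinor u) ∎)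
    where
    u T U a′ b′ : ℝ
    u = step k
    T = fromℕ (suc k)
    U = ∏-const u m
    a′ = reversedQuotient v u
    b′ = reversedQuotient w u

  trace-difference : ∑ w - ∑ v ≈ 1ℝ
  trace-difference = R.trans (solve 2 (λ v w → w :- v := :- v :- :- w) ≈-refl (∑ v) (∑ w))
    (lim-unique
      (lim-sub (lim-reversedQuotient v) (lim-reversedQuotient w))
      (lim-cong (λ k → R.sym (reversedQuotient-difference k)) ≈-refl lim-scaledMinor))

term≤∑ : {x : Vector ℝ m} → (∀ i → NonNeg (x i)) → ∀ j → NonNeg (∑ x - x j)
term≤∑ {suc m} {x} x≥0 j = NonNeg-cong
  (R.trans (solve 2 (λ a r → r := (a :+ r) :- a) ≈-refl (x j) (∑ (removeAt x j)))
           (+-cong (≈-sym (∑.sum-remove {i = j} x)) ≈-refl))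
  (∑-NonNeg λ i → x≥0 (punchIn j i))

splits≈ : {X : Matrix m} (e : Eigenvalues X) → ∀ t → charPoly X t ≈ poly (eig e) t
splits≈ e t = mk≈ (splits e t)

eig-decreasing : {X : Matrix m} (e : Eigenvalues X) → Decreasing (eig e)
eig-decreasing e i≤j = ≤⇒NonNeg (decreasing e i≤j)

-- The order is an arbitrary `m` because `2 ^ ω n` is not syntactically a successor; the index `j`
-- rules out `m = 0`. The upper bound holds because nonnegative gaps with sum 1 are each at most 1.
rankOne-interlacing : (X : Matrix m) → Symmetric X →
  (λX : Eigenvalues X) (λY : Eigenvalues (X -ᴹ diagonal (firstEntry (- 1ℝ)))) → ∀ j →
  NonNeg (eig λY j - eig λX j) × NonNeg (1ℝ - (eig λY j - eig λX j))
rankOne-interlacing {suc m} X X-sym λX λY j = gap≥0 j ,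
  NonNeg-cong (+-cong total ≈-refl) (term≤∑ gap≥0 j)
  where
  v w : Vector ℝ (suc m)
  v = eig λX
  w = eig λY

  gap≥0 : ∀ i → NonNeg (w i - v i)
  gap≥0 = dominated v w (eig-decreasing λX) (eig-decreasing λY)
    (RankOne.excess-NonNeg X X-sym v w (splits≈ λX) (splits≈ λY))

  total : (∑ λ i → w i - v i) ≈ 1ℝ
  total = begin
    (∑ λ i → w i - v i)
      ≈⟨ ∑.sum-cong-≋ (λ i → +-cong (≈-sym (R.*-identityˡ (w i))) (≈-refl { - v i})) ⟩
    (∑ λ i → 1ℝ * w i - v i)
      ≈⟨ ∑-scale-sub 1ℝ w v ⟩
    1ℝ * ∑ w - ∑ v
      ≈⟨ +-cong (R.*-identityˡ (∑ w)) ≈-refl ⟩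
    ∑ w - ∑ v
      ≈⟨ RankOne.trace-difference X X-sym v w (splits≈ λX) (splits≈ λY) ⟩
    1ℝ ∎

root⇒eigenvalue : {X : Matrix m} (e : Eigenvalues X) → ∀ t → charPoly X t ≈ 0ℝ →
                  ¬ ¬ (∃[ i ] t - eig e i ≈ 0ℝ)
root⇒eigenvalue e t root = ∏≈0⇒ (R.trans (R.sym (splits≈ e t)) root)

-- A root of the characteristic polynomial equals some listed eigenvalue, which lies above the last
-- one. Exhibiting a root thus bounds an extreme eigenvalue without determining the whole list.
smallest≤root : {X : Matrix m} (e : Eigenvalues X) → ∀ t → charPoly X t ≈ 0ℝ →
  ∀ l → (∀ i → i Fin.≤ l) → NonNeg (t - eig e l)
smallest≤root e t root l l-last = NonNeg-stable λ k → root⇒eigenvalue e t root λ (i , t≈eᵢ) →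
  k (NonNeg-chain (NonNeg-0 t≈eᵢ) (eig-decreasing e (l-last i)))

root≤largest : {X : Matrix m} (e : Eigenvalues X) → ∀ t → charPoly X t ≈ 0ℝ →
  ∀ f → (∀ i → f Fin.≤ i) → NonNeg (eig e f - t)
root≤largest e t root f f-first = NonNeg-stable λ k → root⇒eigenvalue e t root λ (i , t≈eᵢ) →
  k (NonNeg-chain (eig-decreasing e (f-first i)) (NonNeg-0
    (R.trans (solve 2 (λ t x → x :- t := :- (t :- x)) ≈-refl t (eig e i))
      (R.trans (neg-cong t≈eᵢ) (solve 0 (:- con 0ℚ := con 0ℚ) ≈-refl)))))

-- The eigenvalues of D

-- Keeps det folded when X is a concrete matrix.
charPoly≈det : (X : Matrix m) → ∀ t → charPoly X t ≈ det (charMatrix X t)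
charPoly≈det X t = ≈-refl

charPoly-firstEntry-x : ∀ x → 0 ℕ.< m → charPoly (diagonal {m} (firstEntry x)) x ≈ 0ℝ
charPoly-firstEntry-x {suc m} x _ = R.trans (charPoly≈det X x) (det-zeroRow₀ (charMatrix X x) λ where
    Fin.zero    → R.-‿inverseʳ x
    (Fin.suc _) → R.-‿inverseʳ 0ℝ)
  where
  X : Matrix (suc m)
  X = diagonal (firstEntry x)

-- At t = 0 row 1 of the characteristic matrix vanishes, on and off the diagonal. Order at least 2
-- is essential, as a matrix of order 1 has `x` as its only eigenvalue; this is where `2 ≤ n`
-- enters.
charPoly-firstEntry-0 : ∀ x → 1 ℕ.< m → charPoly (diagonal {m} (firstEntry x)) 0ℝ ≈ 0ℝ
charPoly-firstEntry-0 {suc zero} x (ℕ.s≤s ())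
charPoly-firstEntry-0 {suc (suc m)} x _ =
  R.trans (charPoly≈det X 0ℝ) (det-zeroRow₁ (charMatrix X 0ℝ) λ j → entry (does (Fin.suc Fin.zero Fin.≟ j)) 0ℝ)
  where
  X : Matrix (suc (suc m))
  X = diagonal (firstEntry x)
  entry : ∀ b z → (if b then z else z) - (if b then z else z) ≈ 0ℝ
  entry true  z = R.-‿inverseʳ z
  entry false z = R.-‿inverseʳ z

-- Extreme indices and the existence of a prime divisor

toℕ-first : ∀ r → toℕ (first r) ≡ 0
toℕ-first r = Fin.toℕ-fromℕ< (ℕ.m^n>0 2 r)

first-≤ : ∀ r (i : Fin (2 ℕ.^ r)) → first r Fin.≤ i
first-≤ r i = ℕ.≤-trans (ℕ.≤-reflexive (toℕ-first r)) ℕ.z≤n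

≤-last : ∀ r (i : Fin (2 ℕ.^ r)) → i Fin.≤ last r
≤-last r i = ≡.subst (toℕ i ℕ.≤_) (≡.sym toℕ-last) (ℕ.pred-mono-≤ (Fin.toℕ<n i))
  where
  toℕ-last : toℕ (last r) ≡ ℕ.pred (2 ℕ.^ r)
  toℕ-last = ≡.trans (Fin.opposite-prop (first r))
    (≡.trans (≡.cong (λ k → 2 ℕ.^ r ℕ.∸ suc k) (toℕ-first r)) (∸1 (2 ℕ.^ r)))
    where
    ∸1 : ∀ k → k ℕ.∸ 1 ≡ ℕ.pred k
    ∸1 zero    = refl
    ∸1 (suc k) = refl

prime-divisor : ∀ n → 2 ℕ.≤ n → ∃[ p ] (Prime p × p ∣ n)
prime-divisor n@(suc _) 2≤n with factorise n
... | record { factors = List.[] ; isFactorisation = n≡1 } = contradiction (≡.subst (2 ℕ.≤_) n≡1 2≤n) λ { (ℕ.s≤s ()) }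
... | record { factors = p List.∷ _ ; isFactorisation = n≡ ; factorsPrime = p-prime All.∷ _ } =
  p , p-prime , ∣-trans (m∣m*n _) (∣-reflexive (≡.sym n≡))

ω>0 : ∀ n → 2 ℕ.≤ n → 0 ℕ.< ω n
ω>0 n@(suc _) 2≤n =
  let (p , p-prime , p∣n) = prime-divisor n 2≤n
  in ∈-length (∈-filter⁺ (λ p → prime? p ×-dec p ∣? n) (∈-upTo⁺ (ℕ.s≤s (∣⇒≤ p∣n))) (p-prime , p∣n))

-- Symmetry of Q

ρ-sym : ∀ n → Symmetric (ρ n)
ρ-sym n i j with toℕ i in i≡ | toℕ j in j≡
-- Here `ρ` reads `a` at the column index, which transposition changes; both indices have value 0,
-- so they coincide.
... | zero  | zero  = R.reflexive (≡.cong (λ k → √ (φ n ℕ.* a n k)) (Fin.toℕ-injective (≡.trans j≡ (≡.sym i≡))))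
... | zero  | suc _ = ≈-refl
... | suc _ | zero  = ≈-refl
... | suc _ | suc _ = R.reflexive (≡.cong₂ (λ g k → if does (g ℕ.≟ 1) then √ k else 0ℝ)
                        (gcd-comm (d n i) (d n j)) (ℕ.*-comm (a n i) (a n j)))

Q-sym : ∀ n → Symmetric (Q n)
Q-sym n i j = R.trans (entry (i Fin.≟ j)) (R.reflexive (≡.cong
  (if_then firstEntry (fromℕ (φ n) - 1ℝ) j else ρ n j i) (≟-swap i j)))
  where
  entry : (i≟j : Dec (i ≡ j)) →
    (if does i≟j then firstEntry (fromℕ (φ n) - 1ℝ) i else ρ n i j) ≈
    (if does i≟j then firstEntry (fromℕ (φ n) - 1ℝ) j else ρ n j i)
  entry (yes refl) = ≈-refl
  entry (no _)     = ρ-sym n i j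

theorem4p2p8 : (n : ℕ) → 2 ℕ.≤ n →
    (λQ : Eigenvalues (Q n)) (λQ̃ : Eigenvalues (Q̃ n)) (λD : Eigenvalues (D (ω n))) →
    (j : Fin (2 ℕ.^ ω n)) →
    (eig λQ̃ j + eig λD (last (ω n)) ≤ eig λQ j) ×
    (eig λQ j ≤ eig λQ̃ j + eig λD (first (ω n)))
theorem4p2p8 n 2≤n λQ λQ̃ λD j =
  -- The gap bound μ ≤ λ + 1 is combined with the last eigenvalue of D being at most -1.
  NonNeg⇒≤ (NonNeg-cong
    (solve 3 (λ v w d → (con 1ℚ :- (w :- v)) :+ (:- con 1ℚ :- d) := v :- (w :+ d)) ≈-refl
      (eig λQ j) (eig λQ̃ j) (eig λD (last (ω n))))
    (NonNeg-+ (proj₂ gap) last≤-1)) ,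
  -- Here λ ≤ μ is combined with the first eigenvalue of D being at least 0.
  NonNeg⇒≤ (NonNeg-cong
    (solve 3 (λ v w d → (w :- v) :+ (d :- con 0ℚ) := (w :+ d) :- v) ≈-refl
      (eig λQ j) (eig λQ̃ j) (eig λD (first (ω n))))
    (NonNeg-+ (proj₁ gap) 0≤first))
  where
  1<2^ω : 1 ℕ.< 2 ℕ.^ ω n
  1<2^ω = ℕ.^-monoʳ-< 2 (ℕ.s≤s (ℕ.s≤s ℕ.z≤n)) (ω>0 n 2≤n)

  gap : NonNeg (eig λQ̃ j - eig λQ j) × NonNeg (1ℝ - (eig λQ̃ j - eig λQ j))
  gap = rankOne-interlacing (Q n) (Q-sym n) λQ λQ̃ j

  last≤-1 : NonNeg (- 1ℝ - eig λD (last (ω n)))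
  last≤-1 = smallest≤root λD (- 1ℝ) (charPoly-firstEntry-x (- 1ℝ) (ℕ.<⇒≤ 1<2^ω)) (last (ω n)) (≤-last (ω n))

  0≤first : NonNeg (eig λD (first (ω n)) - 0ℝ)
  0≤first = root≤largest λD 0ℝ (charPoly-firstEntry-0 (- 1ℝ) 1<2^ω) (first (ω n)) (first-≤ (ω n))
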